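{- There exist absolute constants $c_1,c_2$ such that the following holds. For all integers $1<k\le n$ and every $\varepsilon>0$ there exists a prefix $(2^k,\varepsilon)$-extractor $E\colon\{0,1\}^n\times\{0,1\}^d\to\{0,1\}^m$ with $d=\log n+2\log(1/\varepsilon)+c_1$ and $m=k+d-2\log(1/\varepsilon)-c_2$.
   Context: A bipartite graph (multiple edges allowed) with left part of size $N$, right part of size $M$, and all left vertices of degree $D$ is a $(K,\varepsilon)$-extractor if for every subset $S$ of the left part with $\#S\ge K$ and every subset $Y$ of the right part, $\left|\frac{\#E(S,Y)}{D\cdot\#S}-\frac{\#Y}{M}\right|<\varepsilon$, where $E(S,Y)$ is the set (counted with multiplicity) of edges between $S$ and $Y$. With $N=2^n$, $D=2^d$, $M=2^m$, such a graph is identified with a function $E\colon\{0,1\}^n\times\{0,1\}^d\to\{0,1\}^m$ mapping a left vertex and the index of one of its edges to the corresponding right vertex. A $(2^k,\varepsilon)$-extractor $E\colon\{0,1\}^n\times\{0,1\}^d\to\{0,1\}^m$ is a prefix extractor if for every $i\le k$ the function $E_i\colon\{0,1\}^n\times\{0,1\}^d\to\{0,1\}^{m-i}$ obtained by deleting the last $i$ bits of the output of $E$ is a $(2^{k-i},\varepsilon)$-extractor. Logarithms are base 2; the parameters are assumed to be such that $d,m$ are integers. -}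

module Defs where

open import Data.Bool using (Bool; true; false; if_then_else_)
open import Data.Nat using (ℕ; zero; suc; _+_; _*_; _∸_; _^_; _≤_; s≤s; z≤n)
open import Data.Nat.Properties using (m∸n≤m)
open import Data.Integer using (ℤ; +_; -[1+_])
open import Data.Rational using (ℚ; _/_; _-_; _<_) renaming (_*_ to _*ℚ_)
open import Data.List using (List; []; _∷_; map; _++_)
open import Data.Nat.ListAction using (sum)
open import Data.Product using (_×_)
open import Data.Vec using (Vec; []; _∷_)

allBits : (n : ℕ) → List (Vec Bool n)
allBits zero = [] ∷ []
allBits (suc n) = map (true ∷_) (allBits n) ++ map (false ∷_) (allBits n)

Subset : ℕ → Set
Subset n = Vec Bool n → Bool

indicator : Bool → ℕ
indicator b = if b then 1 else 0

card : {n : ℕ} → Subset n → ℕ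
card {n} S = sum (map (λ x → indicator (S x)) (allBits n))

edgeCount : {n d m : ℕ} → (Vec Bool n → Vec Bool d → Vec Bool m) →
            Subset n → Subset m → ℕ
edgeCount {n} {d} E S Y =
  sum (map (λ x → if S x then sum (map (λ y → indicator (Y (E x y))) (allBits d)) else 0)
           (allBits n))

-- a / b as a rational number (the value for b = 0 is an irrelevant convention;
-- it is never used below since D * #S ≥ 1 and M ≥ 1).
_over_ : ℕ → ℕ → ℚ
a over zero = + 0 / 1
a over suc b = + a / suc b

half : ℚ
half = + 1 / 2

pow2 : ℤ → ℚ
pow2 (+ n) = + (2 ^ n) / 1
pow2 -[1+ zero ] = half
pow2 -[1+ suc n ] = half *ℚ pow2 -[1+ n ]

-- (K, ε)-extractor, with the accuracy given through ε2 = ε² (ε > 0):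
-- |a - b| < ε  is written  (a - b)² < ε².
IsExtractor : (n d m K : ℕ) → (ε2 : ℚ) → (Vec Bool n → Vec Bool d → Vec Bool m) → Set
IsExtractor n d m K ε2 E =
  (S : Subset n) → (Y : Subset m) → K ≤ card S →
  let δ = (edgeCount E S Y over (2 ^ d * card S)) - (card Y over (2 ^ m))
  in (δ *ℚ δ) < ε2

takeLE : {A : Set} {m : ℕ} (j : ℕ) → j ≤ m → Vec A m → Vec A j
takeLE zero _ _ = []
takeLE (suc j) (s≤s p) (x ∷ v) = x ∷ takeLE j p v

truncOut : {n d m : ℕ} → (i : ℕ) → (Vec Bool n → Vec Bool d → Vec Bool m) →
           Vec Bool n → Vec Bool d → Vec Bool (m ∸ i)
truncOut {m = m} i E x y = takeLE (m ∸ i) (m∸n≤m m i) (E x y)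

IsPrefixExtractor : (n d m k : ℕ) → (ε2 : ℚ) → (Vec Bool n → Vec Bool d → Vec Bool m) → Set
IsPrefixExtractor n d m k ε2 E =
  IsExtractor n d m (2 ^ k) ε2 E ×
  ((i : ℕ) → i ≤ k → IsExtractor n d (m ∸ i) (2 ^ (k ∸ i)) ε2 (truncOut i E))

nat : ℕ → ℚ
nat n = + n / 1

{-# OPTIONS --safe #-}
module Submission where

-- A random graph works; the probabilistic argument is carried out as a count over the finite list of all
-- graphs.  Replacing Y by its complement, only the deviations #E(S,Y)/(D #S) ≥ #Y/M + ε have to be excluded,
-- and ε may be rounded down to a power 1/J of two.  For one pair (S,Y) an exponential moment with the integral
-- weights (h+1)^M and h^M, h = 4JM, bounds the fraction of bad graphs by 4^(-D #S / (16 J²)) ≤ 2^(-8n #S),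
-- because D ε² = 2⁷ n.  After deletion of i bits there are 2^(2^(m-i)) ≤ 2^(n #S) tests Y for a set S with
-- #S ≥ 2^(k-i), since 2^m = 2^k n.  Finally ∑_S 2^(-n #S) = (1 + 2^(-n))^(2^n) ≤ 4 takes care of the sum over
-- the sets S, and a factor 2^(-6n) is left for the sum over i ≤ k.
-- If ε ≥ 1, every graph works because |#E(S,Y)/(D #S) - #Y/M| < 1.

open import Defs
open import Data.Bool using (Bool; true; false; if_then_else_; not; T)
open import Data.Fin using (Fin; toℕ; fromℕ<)
open import Data.Fin.Properties using (toℕ≤pred[n]; toℕ-fromℕ<)
open import Data.List using (List; []; _∷_; map; _++_; length; cartesianProductWith; allFin)
open import Data.List.Membership.Propositional using (_∈_)
open import Data.List.Membership.Propositional.Properties using (∈-map⁺; ∈-++⁺ˡ; ∈-++⁺ʳ; ∈-allFin; ∈-cartesianProductWith⁺)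
open import Data.List.Properties using (map-++; map-∘; map-cong; length-map; length-++; length-tabulate)
open import Data.List.Relation.Unary.Any using (here; there)
open import Data.Nat
open import Data.Nat.ListAction using (sum; product)
open import Data.Nat.ListAction.Properties using (sum-++; product-++)
open import Data.Nat.Properties
open import Data.Nat.Tactic.RingSolver using (solve-∀)
open import Data.Product using (Σ; ∃; _×_; _,_; proj₁; proj₂)
open import Data.Sum using (inj₁; inj₂)
open import Data.Unit using (tt)
open import Data.Vec using (Vec; []; _∷_; replicate)
open import Function using (_∘_; id)
open import Relation.Binary.PropositionalEquality
open import Relation.Nullary using (yes; no; contradiction)

-- Powers of 1 + 1/h

-- Bernoulli's inequality `1 + a/h ≤ (1 + 1/h)^a`, multiplied by `h ^ a * h`. In the induction the
-- surplus `h ^ a * a` is dropped.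
bernoulli : ∀ h a → h ^ a * (h + a) ≤ suc h ^ a * h
bernoulli h zero = ≤-reflexive (cong (1 *_) (+-identityʳ h))
bernoulli h (suc a) = begin
  h * h ^ a * (h + suc a)                  ≤⟨ m≤m+n _ _ ⟩
  h * h ^ a * (h + suc a) + h ^ a * a      ≡⟨ expand h (h ^ a) a ⟩
  suc h * (h ^ a * (h + a))                ≤⟨ *-monoʳ-≤ (suc h) (bernoulli h a) ⟩
  suc h * (suc h ^ a * h)                  ≡⟨ *-assoc (suc h) (suc h ^ a) h ⟨
  suc h * suc h ^ a * h                    ∎
  where
  open ≤-Reasoning
  expand : ∀ h p a → h * p * (h + (1 + a)) + p * a ≡ (1 + h) * (p * (h + a))
  expand = solve-∀

-- (1 + 1/h)^a ≤ 1 + a/h + (a/h)²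
power-upper-bound : ∀ h a → a ≤ h → suc h ^ a * (h * h) ≤ h ^ a * (h * h + a * h + a * a)
power-upper-bound h zero _ = ≤-reflexive (base h)
  where
  base : ∀ h → 1 * (h * h) ≡ 1 * (h * h + 0 * h + 0 * 0)
  base = solve-∀
power-upper-bound h (suc a) a<h = begin
  suc h * suc h ^ a * (h * h)                                 ≡⟨ *-assoc (suc h) (suc h ^ a) (h * h) ⟩
  suc h * (suc h ^ a * (h * h))                               ≤⟨ *-monoʳ-≤ (suc h) (power-upper-bound h a a≤h) ⟩
  suc h * (h ^ a * (h * h + a * h + a * a))                   ≡⟨ expandˡ h (h ^ a) a ⟩
  -- The induction leaves `a * a` where `a * h + h` is available; `a ≤ h` is what closes this gap.
  h ^ a * (c + a * a)                                         ≤⟨ *-monoʳ-≤ (h ^ a) (+-monoʳ-≤ c (*-monoʳ-≤ a a≤h)) ⟩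
  h ^ a * (c + a * h)                                         ≤⟨ *-monoʳ-≤ (h ^ a) (m≤m+n (c + a * h) h) ⟩
  h ^ a * (c + a * h + h)                                     ≡⟨ expandʳ h (h ^ a) a ⟩
  h * h ^ a * (h * h + suc a * h + suc a * suc a)             ∎
  where
  open ≤-Reasoning
  a≤h = <⇒≤ a<h
  c = h * h * h + a * h * h + a * a * h + h * h + a * h
  expandˡ : ∀ h p a → (1 + h) * (p * (h * h + a * h + a * a)) ≡
                      p * (h * h * h + a * h * h + a * a * h + h * h + a * h + a * a)
  expandˡ = solve-∀
  expandʳ : ∀ h p a → p * (h * h * h + a * h * h + a * a * h + h * h + a * h + a * h + h) ≡
                      h * p * (h * h + (1 + a) * h + (1 + a) * (1 + a))
  expandʳ = solve-∀

-- With the next lemma this places `(1 + 1/h)^h` between 2 and 4. The lower bound measures how heavy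
-- a bad graph is; the upper bound controls the average weight and, with `h = 2 ^ n`, the sum over
-- all sets.
2*h^h≤[1+h]^h : ∀ h .{{_ : NonZero h}} → 2 * h ^ h ≤ suc h ^ h
2*h^h≤[1+h]^h h = *-cancelʳ-≤ _ _ h (begin
  2 * h ^ h * h     ≡⟨ shuffle h (h ^ h) ⟩
  h ^ h * (h + h)   ≤⟨ bernoulli h h ⟩
  suc h ^ h * h     ∎)
  where
  open ≤-Reasoning
  shuffle : ∀ h p → 2 * p * h ≡ p * (h + h)
  shuffle = solve-∀

[1+h]^h≤4*h^h : ∀ h .{{_ : NonZero h}} → suc h ^ h ≤ 4 * h ^ h
[1+h]^h≤4*h^h h = *-cancelʳ-≤ _ _ (h * h) {{m*n≢0 h h}} (begin
  suc h ^ h * (h * h)                  ≤⟨ power-upper-bound h h ≤-refl ⟩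
  -- The constant obtained is 3; it is rounded up to a power of two.
  h ^ h * (h * h + h * h + h * h)      ≤⟨ *-monoʳ-≤ (h ^ h) (m≤m+n _ (h * h)) ⟩
  h ^ h * (h * h + h * h + h * h + h * h) ≡⟨ shuffle h (h ^ h) ⟩
  4 * h ^ h * (h * h)                  ∎)
  where
  open ≤-Reasoning
  shuffle : ∀ h p → p * (h * h + h * h + h * h + h * h) ≡ 4 * p * (h * h)
  shuffle = solve-∀

-- The moment bound for one edge: with λ = 1/κ and base 1 + λ/M, the average of base^(M·[v ∈ Y])
-- is at most base^#Y · (1 + λ²).
moment-bound : ∀ κ M a b .{{_ : NonZero κ}} .{{_ : NonZero M}} → a + b ≡ M → let h = κ * M in
  (a * suc h ^ M + b * h ^ M) * (h ^ a * (κ * κ)) ≤ M * (suc h ^ a * (suc (κ * κ) * h ^ M))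
moment-bound κ M a b a+b≡M = *-cancelʳ-≤ _ _ (κ * (M * M)) {{m*n≢0 κ (M * M)}} (begin
  (a * P + b * p) * (q * (κ * κ)) * (κ * (M * M))
    ≡⟨ e₁ κ M a b P p q ⟩
  -- The cancelled factor `κ * (M * M)` supplies the `h * h` that `power-upper-bound` needs; it is
  -- applied with exponent `M ≤ h`.
  (a * (P * (h * h)) + b * p * (h * h)) * (q * κ)
    ≤⟨ *-monoˡ-≤ (q * κ) (+-monoˡ-≤ _ (*-monoʳ-≤ a (power-upper-bound h M (m≤n*m M κ)))) ⟩
  (a * (p * (h * h + M * h + M * M)) + b * p * (h * h)) * (q * κ)
    ≡⟨ e₂ κ M a b p q ⟩
  p * (M * M) * q * (κ * κ * κ * (a + b) + a * κ * κ + a * κ)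
    ≡⟨ cong (λ z → p * (M * M) * q * (κ * κ * κ * z + a * κ * κ + a * κ)) a+b≡M ⟩
  p * (M * M) * q * (κ * κ * κ * M + a * κ * κ + a * κ)
    ≤⟨ *-monoʳ-≤ (p * (M * M) * q) (+-mono-≤ (≤-refl {κ * κ * κ * M + a * κ * κ}) (*-monoˡ-≤ κ a≤M)) ⟩
  -- Adding `a` completes the product `(1 + κ * κ) * (h + a)`, so that Bernoulli can trade `h + a`
  -- for a power of `suc h`.
  p * (M * M) * q * (κ * κ * κ * M + a * κ * κ + M * κ)
    ≤⟨ *-monoʳ-≤ (p * (M * M) * q) (m≤m+n _ a) ⟩
  p * (M * M) * q * (κ * κ * κ * M + a * κ * κ + M * κ + a)
    ≡⟨ e₃ κ M a p q ⟩
  p * (M * M) * suc (κ * κ) * (q * (h + a))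
    ≤⟨ *-monoʳ-≤ (p * (M * M) * suc (κ * κ)) (bernoulli h a) ⟩
  p * (M * M) * suc (κ * κ) * (Q * h)
    ≡⟨ e₄ κ M p Q ⟩
  M * (Q * (suc (κ * κ) * p)) * (κ * (M * M)) ∎)
  where
  open ≤-Reasoning
  instance
    M²≢0 : NonZero (M * M)
    M²≢0 = m*n≢0 M M
  h = κ * M
  P = suc h ^ M
  p = h ^ M
  Q = suc h ^ a
  q = h ^ a
  a≤M : a ≤ M
  a≤M = subst (a ≤_) a+b≡M (m≤m+n a b)
  e₁ : ∀ κ M a b P p q → (a * P + b * p) * (q * (κ * κ)) * (κ * (M * M)) ≡
       (a * (P * (κ * M * (κ * M))) + b * p * (κ * M * (κ * M))) * (q * κ)
  e₁ = solve-∀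
  e₂ : ∀ κ M a b p q →
       (a * (p * (κ * M * (κ * M) + M * (κ * M) + M * M)) + b * p * (κ * M * (κ * M))) * (q * κ) ≡
       p * (M * M) * q * (κ * κ * κ * (a + b) + a * κ * κ + a * κ)
  e₂ = solve-∀
  e₃ : ∀ κ M a p q → p * (M * M) * q * (κ * κ * κ * M + a * κ * κ + M * κ + a) ≡
       p * (M * M) * (1 + κ * κ) * (q * (κ * M + a))
  e₃ = solve-∀
  e₄ : ∀ κ M p Q → p * (M * M) * (1 + κ * κ) * (Q * (κ * M)) ≡ M * (Q * ((1 + κ * κ) * p)) * (κ * (M * M))
  e₄ = solve-∀

-- Finite sums and products

private variable
  I₁ I₂ I₃ : Set

∑ ∏ : List I₁ → (I₁ → ℕ) → ℕ
∑ xs f = sum (map f xs)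
∏ xs f = product (map f xs)

∑-cong : ∀ (xs : List I₁) {f g : I₁ → ℕ} → f ≗ g → ∑ xs f ≡ ∑ xs g
∑-cong xs f≗g = cong sum (map-cong f≗g xs)

∏-cong : ∀ (xs : List I₁) {f g : I₁ → ℕ} → f ≗ g → ∏ xs f ≡ ∏ xs g
∏-cong xs f≗g = cong product (map-cong f≗g xs)

∑-mono : ∀ (xs : List I₁) {f g : I₁ → ℕ} → (∀ x → f x ≤ g x) → ∑ xs f ≤ ∑ xs g
∑-mono []       f≤g = z≤n
∑-mono (x ∷ xs) f≤g = +-mono-≤ (f≤g x) (∑-mono xs f≤g)

∏-mono : ∀ (xs : List I₁) {f g : I₁ → ℕ} → (∀ x → f x ≤ g x) → ∏ xs f ≤ ∏ xs g
∏-mono []       f≤g = ≤-refl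
∏-mono (x ∷ xs) f≤g = *-mono-≤ (f≤g x) (∏-mono xs f≤g)

∑-+ : ∀ (xs : List I₁) (f g : I₁ → ℕ) → ∑ xs (λ x → f x + g x) ≡ ∑ xs f + ∑ xs g
∑-+ []       f g = refl
∑-+ (x ∷ xs) f g = trans (cong (f x + g x +_) (∑-+ xs f g)) (interchange (f x) (g x) (∑ xs f) (∑ xs g))
  where
  interchange : ∀ a b c d → a + b + (c + d) ≡ a + c + (b + d)
  interchange = solve-∀

∏-* : ∀ (xs : List I₁) (f g : I₁ → ℕ) → ∏ xs (λ x → f x * g x) ≡ ∏ xs f * ∏ xs g
∏-* []       f g = refl
∏-* (x ∷ xs) f g = trans (cong (f x * g x *_) (∏-* xs f g)) (interchange (f x) (g x) (∏ xs f) (∏ xs g))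
  where
  interchange : ∀ a b c d → a * b * (c * d) ≡ a * c * (b * d)
  interchange = solve-∀

∑-*ʳ : ∀ (xs : List I₁) (f : I₁ → ℕ) c → ∑ xs (λ x → f x * c) ≡ ∑ xs f * c
∑-*ʳ []       f c = refl
∑-*ʳ (x ∷ xs) f c = trans (cong (f x * c +_) (∑-*ʳ xs f c)) (sym (*-distribʳ-+ c (f x) (∑ xs f)))

∑-const : ∀ (xs : List I₁) c → ∑ xs (λ _ → c) ≡ length xs * c
∑-const []       c = refl
∑-const (x ∷ xs) c = cong (c +_) (∑-const xs c)

∑-0 : ∀ (xs : List I₁) → ∑ xs (λ _ → 0) ≡ 0
∑-0 xs = trans (∑-const xs 0) (*-zeroʳ (length xs))

∏-const : ∀ (xs : List I₁) c → ∏ xs (λ _ → c) ≡ c ^ length xs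
∏-const []       c = refl
∏-const (x ∷ xs) c = cong (c *_) (∏-const xs c)

∏-^ : ∀ (xs : List I₁) c (e : I₁ → ℕ) → ∏ xs (λ x → c ^ e x) ≡ c ^ ∑ xs e
∏-^ []       c e = refl
∏-^ (x ∷ xs) c e = trans (cong (c ^ e x *_) (∏-^ xs c e)) (sym (^-distribˡ-+-* c (e x) (∑ xs e)))

∑-++ : ∀ (xs ys : List I₁) f → ∑ (xs ++ ys) f ≡ ∑ xs f + ∑ ys f
∑-++ xs ys f = trans (cong sum (map-++ f xs ys)) (sum-++ (map f xs) (map f ys))

∏-++ : ∀ (xs ys : List I₁) f → ∏ (xs ++ ys) f ≡ ∏ xs f * ∏ ys f
∏-++ xs ys f = trans (cong product (map-++ f xs ys)) (product-++ (map f xs) (map f ys))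

∑-map : ∀ (g : I₁ → I₂) xs f → ∑ (map g xs) f ≡ ∑ xs (f ∘ g)
∑-map g xs f = cong sum (sym (map-∘ xs))

∏-map : ∀ (g : I₁ → I₂) xs f → ∏ (map g xs) f ≡ ∏ xs (f ∘ g)
∏-map g xs f = cong product (sym (map-∘ xs))

∑-swap : ∀ (xs : List I₁) (ys : List I₂) (f : I₁ → I₂ → ℕ) →
         ∑ xs (λ x → ∑ ys (f x)) ≡ ∑ ys (λ y → ∑ xs (λ x → f x y))
∑-swap []       ys f = sym (∑-0 ys)
∑-swap (x ∷ xs) ys f = trans (cong (∑ ys (f x) +_) (∑-swap xs ys f)) (sym (∑-+ ys (f x) _))

∑-cartesianProductWith : ∀ (g : I₁ → I₂ → I₃) xs ys f →
  ∑ (cartesianProductWith g xs ys) f ≡ ∑ xs (λ x → ∑ ys (λ y → f (g x y)))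
∑-cartesianProductWith g []       ys f = refl
∑-cartesianProductWith g (x ∷ xs) ys f =
  trans (∑-++ (map (g x) ys) _ f) (cong₂ _+_ (∑-map (g x) ys f) (∑-cartesianProductWith g xs ys f))

∈⇒≤∑ : ∀ {xs : List I₁} (f : I₁ → ℕ) {x} → x ∈ xs → f x ≤ ∑ xs f
∈⇒≤∑ f (here refl)  = m≤m+n _ _
∈⇒≤∑ f (there x∈xs) = ≤-trans (∈⇒≤∑ f x∈xs) (m≤n+m _ _)

-- The first-moment method: if the graphs fail less than once on average, some graph never fails.
-- Each nonzero term uses up at least one unit of the slack.
∑<length⇒∃≡0 : ∀ (xs : List I₁) (f : I₁ → ℕ) → ∑ xs f < length xs → ∃ λ x → f x ≡ 0
∑<length⇒∃≡0 (x ∷ xs) f lt with f x in eq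
... | zero  = x , eq
... | suc c = ∑<length⇒∃≡0 xs f (≤-<-trans (m≤n+m (∑ xs f) c) (s<s⁻¹ lt))

-- Sums over cubes and over spaces of functions on cubes

∑-allBits : ∀ a f → ∑ (allBits (suc a)) f ≡ ∑ (allBits a) (f ∘ (true ∷_)) + ∑ (allBits a) (f ∘ (false ∷_))
∑-allBits a f = trans (∑-++ (map (true ∷_) (allBits a)) _ f)
                      (cong₂ _+_ (∑-map (true ∷_) (allBits a) f) (∑-map (false ∷_) (allBits a) f))

∏-allBits : ∀ a f → ∏ (allBits (suc a)) f ≡ ∏ (allBits a) (f ∘ (true ∷_)) * ∏ (allBits a) (f ∘ (false ∷_))
∏-allBits a f = trans (∏-++ (map (true ∷_) (allBits a)) _ f)
                      (cong₂ _*_ (∏-map (true ∷_) (allBits a) f) (∏-map (false ∷_) (allBits a) f))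

length-allBits : ∀ a → length (allBits a) ≡ 2 ^ a
length-allBits zero    = refl
length-allBits (suc a) = begin
  length (map (true ∷_) (allBits a) ++ map (false ∷_) (allBits a))
    ≡⟨ length-++ (map (true ∷_) (allBits a)) ⟩
  length (map (true ∷_) (allBits a)) + length (map (false ∷_) (allBits a))
    ≡⟨ cong₂ _+_ (length-map _ (allBits a)) (length-map _ (allBits a)) ⟩
  length (allBits a) + length (allBits a)
    ≡⟨ cong₂ _+_ (length-allBits a) (trans (length-allBits a) (sym (+-identityʳ (2 ^ a)))) ⟩
  2 ^ suc a ∎
  where open ≡-Reasoning

glue : ∀ {a} → (Vec Bool a → I₁) → (Vec Bool a → I₁) → Vec Bool (suc a) → I₁
glue g h (true  ∷ x) = g x
glue g h (false ∷ x) = h x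

functions : ∀ a → List I₁ → List (Vec Bool a → I₁)
functions zero    vs = map (λ v _ → v) vs
functions (suc a) vs = cartesianProductWith glue (functions a vs) (functions a vs)

-- Independence of the values of a random function: the expectation of a product over the points is
-- the product of the expectations. A function on the larger cube is a pair of functions on its
-- halves, so the sum factors.
∑-functions-∏ : ∀ a (vs : List I₁) (φ : Vec Bool a → I₁ → ℕ) →
  ∑ (functions a vs) (λ f → ∏ (allBits a) (λ x → φ x (f x))) ≡ ∏ (allBits a) (λ x → ∑ vs (φ x))
∑-functions-∏ zero vs φ = trans (∑-map (λ v _ → v) vs _) (∑-*ʳ vs (φ []) 1)
∑-functions-∏ (suc a) vs φ = begin
  ∑ (functions (suc a) vs) (λ f → ∏ (allBits (suc a)) (λ x → φ x (f x)))
    ≡⟨ ∑-cartesianProductWith glue F F _ ⟩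
  ∑ F (λ g → ∑ F (λ h → ∏ (allBits (suc a)) (λ x → φ x (glue g h x))))
    ≡⟨ ∑-cong F (λ g → ∑-cong F (λ h → trans (∏-allBits a _) (*-comm (Φ true g) (Φ false h)))) ⟩
  ∑ F (λ g → ∑ F (λ h → Φ false h * Φ true g))
    ≡⟨ ∑-cong F (λ g → trans (∑-*ʳ F (Φ false) (Φ true g)) (*-comm (∑ F (Φ false)) (Φ true g))) ⟩
  ∑ F (λ g → Φ true g * ∑ F (Φ false))
    ≡⟨ ∑-*ʳ F (Φ true) _ ⟩
  ∑ F (Φ true) * ∑ F (Φ false)
    ≡⟨ cong₂ _*_ (∑-functions-∏ a vs (φ ∘ (true ∷_))) (∑-functions-∏ a vs (φ ∘ (false ∷_))) ⟩
  ∏ (allBits a) (λ x → ∑ vs (φ (true ∷ x))) * ∏ (allBits a) (λ x → ∑ vs (φ (false ∷ x)))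
    ≡⟨ ∏-allBits a _ ⟨
  ∏ (allBits (suc a)) (λ x → ∑ vs (φ x)) ∎
  where
  open ≡-Reasoning
  F = functions a vs
  Φ : Bool → (Vec Bool a → _) → ℕ
  Φ b g = ∏ (allBits a) (λ x → φ (b ∷ x) (g x))

length-functions : ∀ a (vs : List I₁) → length (functions a vs) ≡ length vs ^ 2 ^ a
length-functions a vs = begin
  length F                                        ≡⟨ *-identityʳ (length F) ⟨
  length F * 1                                    ≡⟨ ∑-const F 1 ⟨
  ∑ F (λ _ → 1)                                   ≡⟨ ∑-cong F (λ _ → sym ∏1≡1) ⟩
  ∑ F (λ _ → ∏ (allBits a) (λ _ → 1))             ≡⟨ ∑-functions-∏ a vs (λ _ _ → 1) ⟩
  ∏ (allBits a) (λ _ → ∑ vs (λ _ → 1))            ≡⟨ ∏-const (allBits a) _ ⟩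
  ∑ vs (λ _ → 1) ^ length (allBits a)
    ≡⟨ cong₂ _^_ (trans (∑-const vs 1) (*-identityʳ (length vs))) (length-allBits a) ⟩
  length vs ^ 2 ^ a ∎
  where
  open ≡-Reasoning
  F = functions a vs
  ∏1≡1 : ∏ (allBits a) (λ _ → 1) ≡ 1
  ∏1≡1 = trans (∏-const (allBits a) 1) (^-zeroˡ (length (allBits a)))

-- Without function extensionality a given function is listed only up to `≗`. This is why `card`,
-- `edgeCount` and `isBad` need congruence lemmas.
functions-complete : ∀ a {vs : List I₁} (f : Vec Bool a → I₁) → (∀ x → f x ∈ vs) →
  ∃ λ g → g ∈ functions a vs × g ≗ f
functions-complete zero    f f∈ = _ , ∈-map⁺ (λ v _ → v) (f∈ []) , λ { [] → refl }
functions-complete (suc a) f f∈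
  with g , g∈ , g≗ ← functions-complete a (f ∘ (true ∷_)) (f∈ ∘ (true ∷_))
     | h , h∈ , h≗ ← functions-complete a (f ∘ (false ∷_)) (f∈ ∘ (false ∷_)) =
  glue g h , ∈-cartesianProductWith⁺ glue g∈ h∈ , λ { (true ∷ x) → g≗ x ; (false ∷ x) → h≗ x }

bools : List Bool
bools = true ∷ false ∷ []

subsets : ∀ a → List (Subset a)
subsets a = functions a bools

subsets-complete : ∀ {a} (S : Subset a) → ∃ λ S′ → S′ ∈ subsets a × S′ ≗ S
subsets-complete S = functions-complete _ S (λ x → ∈-bools (S x))
  where
  ∈-bools : ∀ b → b ∈ bools
  ∈-bools true  = here refl
  ∈-bools false = there (here refl)

-- Cardinalities and edge counts

∁ : ∀ {a} → Subset a → Subset a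
∁ Y v = not (Y v)

card-cong : ∀ {a} {S S′ : Subset a} → S ≗ S′ → card S ≡ card S′
card-cong S≗S′ = ∑-cong (allBits _) (λ x → cong indicator (S≗S′ x))

∑-indicator-not : ∀ (xs : List I₁) (b : I₁ → Bool) →
  ∑ xs (indicator ∘ b) + ∑ xs (indicator ∘ not ∘ b) ≡ length xs
∑-indicator-not []       b = refl
∑-indicator-not (x ∷ xs) b with b x
... | true  = cong suc (∑-indicator-not xs b)
... | false = trans (+-suc _ _) (cong suc (∑-indicator-not xs b))

card+card-∁ : ∀ {a} (Y : Subset a) → card Y + card (∁ Y) ≡ 2 ^ a
card+card-∁ {a} Y = trans (∑-indicator-not (allBits a) Y) (length-allBits a)

∑-if : ∀ (xs : List I₁) (b : I₁ → Bool) p q →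
  ∑ xs (λ x → if b x then p else q) ≡ ∑ xs (indicator ∘ b) * p + ∑ xs (indicator ∘ not ∘ b) * q
∑-if [] b p q = refl
∑-if (x ∷ xs) b p q with b x
... | true  = trans (cong (p +_) (∑-if xs b p q)) (sym (+-assoc p _ _))
... | false = trans (cong (q +_) (∑-if xs b p q)) (rotate q (∑ xs (indicator ∘ b) * p) _)
  where
  rotate : ∀ q r s → q + (r + s) ≡ r + (q + s)
  rotate = solve-∀

∏-if-1 : ∀ {a} (S : Subset a) c → ∏ (allBits a) (λ x → if S x then c else 1) ≡ c ^ card S
∏-if-1 S c = trans (∏-cong (allBits _) (λ x → lemma (S x))) (∏-^ (allBits _) c (indicator ∘ S))
  where
  lemma : ∀ b → (if b then c else 1) ≡ c ^ indicator b
  lemma true  = sym (*-identityʳ c)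
  lemma false = refl

-- The product is `p^e q^(l - e)` with `e` the number of true entries and `l` the length; the extra
-- factor `q^e` avoids the subtraction. `weight-edgeCount` has the same form.
∏-if : ∀ (xs : List I₁) (b : I₁ → Bool) p q →
  ∏ xs (λ x → if b x then p else q) * q ^ ∑ xs (indicator ∘ b) ≡ p ^ ∑ xs (indicator ∘ b) * q ^ length xs
∏-if xs b p q = begin
  ∏ xs (λ x → if b x then p else q) * q ^ ∑ xs e                ≡⟨ cong (∏ xs (λ x → if b x then p else q) *_) (∏-^ xs q e) ⟨
  ∏ xs (λ x → if b x then p else q) * ∏ xs (λ x → q ^ e x)      ≡⟨ ∏-* xs _ _ ⟨
  ∏ xs (λ x → (if b x then p else q) * q ^ e x)                 ≡⟨ ∏-cong xs (λ x → lemma (b x)) ⟩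
  ∏ xs (λ x → p ^ e x * q)                                      ≡⟨ ∏-* xs _ _ ⟩
  ∏ xs (λ x → p ^ e x) * ∏ xs (λ _ → q)                         ≡⟨ cong₂ _*_ (∏-^ xs p e) (∏-const xs q) ⟩
  p ^ ∑ xs e * q ^ length xs                                    ∎
  where
  open ≡-Reasoning
  e = indicator ∘ b
  lemma : ∀ b → (if b then p else q) * q ^ indicator b ≡ p ^ indicator b * q
  lemma true  = solve-aux p q
    where
    solve-aux : ∀ p q → p * (q * 1) ≡ p * 1 * q
    solve-aux = solve-∀
  lemma false = trans (*-identityʳ q) (sym (*-identityˡ q))

Graph : (n d m : ℕ) → Set
Graph n d m = Vec Bool n → Vec Bool d → Vec Bool m

edgeCount-cong : ∀ {n d m} (E : Graph n d m) {S S′ Y Y′} → S ≗ S′ → Y ≗ Y′ →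
                 edgeCount E S Y ≡ edgeCount E S′ Y′
edgeCount-cong {n} {d} E {S} {S′} {Y} {Y′} S≗S′ Y≗Y′ =
  ∑-cong (allBits n) (λ x → cong₂ (λ b c → if b then c else 0) (S≗S′ x)
    (∑-cong (allBits d) (λ y → cong indicator (Y≗Y′ (E x y)))))

edgeCount+edgeCount-∁ : ∀ {n d m} (E : Graph n d m) S Y →
                        edgeCount E S Y + edgeCount E S (∁ Y) ≡ 2 ^ d * card S
edgeCount+edgeCount-∁ {n} {d} E S Y = begin
  edgeCount E S Y + edgeCount E S (∁ Y)      ≡⟨ ∑-+ (allBits n) _ _ ⟨
  ∑ (allBits n) (λ x → (if S x then deg Y x else 0) + (if S x then deg (∁ Y) x else 0))
                                             ≡⟨ ∑-cong (allBits n) (λ x → lemma x (S x)) ⟩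
  ∑ (allBits n) (λ x → indicator (S x) * 2 ^ d) ≡⟨ ∑-*ʳ (allBits n) (indicator ∘ S) (2 ^ d) ⟩
  card S * 2 ^ d                             ≡⟨ *-comm (card S) (2 ^ d) ⟩
  2 ^ d * card S                             ∎
  where
  open ≡-Reasoning
  deg = λ Y x → ∑ (allBits d) (λ y → indicator (Y (E x y)))
  lemma : ∀ x b → (if b then deg Y x else 0) + (if b then deg (∁ Y) x else 0) ≡ indicator b * 2 ^ d
  lemma x false = refl
  lemma x true  = trans (∑-indicator-not (allBits d) (Y ∘ E x))
                        (trans (length-allBits d) (sym (*-identityˡ (2 ^ d))))

-- The exponential moment method for a single test

graphs : ∀ n d m → List (Graph n d m)
graphs n d m = functions n (functions d (allBits m))


^-distribʳ-* : ∀ a b c → (a * b) ^ c ≡ a ^ c * b ^ c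
^-distribʳ-* a b zero    = refl
^-distribʳ-* a b (suc c) = trans (cong (a * b *_) (^-distribʳ-* a b c)) (interchange a b (a ^ c) (b ^ c))
  where
  interchange : ∀ a b c d → a * b * (c * d) ≡ a * c * (b * d)
  interchange = solve-∀

-- weight p q S Y E = p^e q^(L - e), where e = edgeCount E S Y and L is the number of edges leaving S.
weight : ∀ {n d m} → ℕ → ℕ → Subset n → Subset m → Graph n d m → ℕ
weight {n} {d} p q S Y E =
  ∏ (allBits n) (λ x → if S x then ∏ (allBits d) (λ y → if Y (E x y) then p else q) else 1)

weight-edgeCount : ∀ {n d m} p q S Y (E : Graph n d m) →
  weight p q S Y E * q ^ edgeCount E S Y ≡ p ^ edgeCount E S Y * q ^ (2 ^ d * card S)
weight-edgeCount {n} {d} p q S Y E = begin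
  weight p q S Y E * q ^ ∑ (allBits n) e                        ≡⟨ cong (weight p q S Y E *_) (∏-^ (allBits n) q e) ⟨
  weight p q S Y E * ∏ (allBits n) (λ x → q ^ e x)              ≡⟨ ∏-* (allBits n) _ _ ⟨
  ∏ (allBits n) (λ x → (if S x then w x else 1) * q ^ e x)      ≡⟨ ∏-cong (allBits n) (λ x → step x (S x)) ⟩
  ∏ (allBits n) (λ x → p ^ e x * (if S x then q ^ 2 ^ d else 1)) ≡⟨ ∏-* (allBits n) _ _ ⟩
  ∏ (allBits n) (λ x → p ^ e x) * ∏ (allBits n) (λ x → if S x then q ^ 2 ^ d else 1)
    ≡⟨ cong₂ _*_ (∏-^ (allBits n) p e) (trans (∏-if-1 S (q ^ 2 ^ d)) (^-*-assoc q (2 ^ d) (card S))) ⟩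
  p ^ edgeCount E S Y * q ^ (2 ^ d * card S)                    ∎
  where
  open ≡-Reasoning
  w deg e : Vec Bool n → ℕ
  w x = ∏ (allBits d) (λ y → if Y (E x y) then p else q)
  deg x = ∑ (allBits d) (λ y → indicator (Y (E x y)))
  e x = if S x then deg x else 0
  step : ∀ x b → (if b then w x else 1) * q ^ (if b then deg x else 0) ≡
                 p ^ (if b then deg x else 0) * (if b then q ^ 2 ^ d else 1)
  step x true  = trans (∏-if (allBits d) (Y ∘ E x) p q) (cong (λ l → p ^ deg x * q ^ l) (length-allBits d))
  step x false = refl

-- The edges leaving `S` are independent and uniform, so the mean weight is a power of the one-edge
-- average, with one factor per edge. The hypothesis bounds that average by `c′ / c`, with
-- denominators cleared.
∑-weight-bound : ∀ {n d m} p q (S : Subset n) (Y : Subset m) c c′ →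
  (card Y * p + card (∁ Y) * q) * c ≤ 2 ^ m * c′ →
  ∑ (graphs n d m) (weight p q S Y) * c ^ (2 ^ d * card S) ≤ length (graphs n d m) * c′ ^ (2 ^ d * card S)
∑-weight-bound {n} {d} {m} p q S Y c c′ bound = begin
  ∑ (graphs n d m) (weight p q S Y) * c ^ (2 ^ d * card S)
    ≡⟨ cong₂ _*_ (∑-functions-∏ n (functions d (allBits m)) φ) (sym (∏-if-^ c)) ⟩
  ∏ (allBits n) (λ x → ∑ (functions d (allBits m)) (φ x)) * ∏ (allBits n) (λ x → if S x then c ^ 2 ^ d else 1)
    ≡⟨ ∏-* (allBits n) _ _ ⟨
  ∏ (allBits n) (λ x → ∑ (functions d (allBits m)) (φ x) * (if S x then c ^ 2 ^ d else 1))
    ≤⟨ ∏-mono (allBits n) (λ x → step (S x)) ⟩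
  ∏ (allBits n) (λ x → length (functions d (allBits m)) * (if S x then c′ ^ 2 ^ d else 1))
    ≡⟨ ∏-* (allBits n) _ _ ⟩
  ∏ (allBits n) (λ _ → length (functions d (allBits m))) * ∏ (allBits n) (λ x → if S x then c′ ^ 2 ^ d else 1)
    ≡⟨ cong₂ _*_ (trans (∏-const (allBits n) _) (trans (cong (_ ^_) (length-allBits n)) (sym (length-functions n _)))) (∏-if-^ c′) ⟩
  length (graphs n d m) * c′ ^ (2 ^ d * card S) ∎
  where
  open ≤-Reasoning
  ω : Vec Bool m → ℕ
  ω v = if Y v then p else q
  φ : Vec Bool n → (Vec Bool d → Vec Bool m) → ℕ
  φ x f = if S x then ∏ (allBits d) (λ y → ω (f y)) else 1
  ∏-if-^ : ∀ c → ∏ (allBits n) (λ x → if S x then c ^ 2 ^ d else 1) ≡ c ^ (2 ^ d * card S)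
  ∏-if-^ c = trans (∏-if-1 S (c ^ 2 ^ d)) (^-*-assoc c (2 ^ d) (card S))
  step : ∀ b → ∑ (functions d (allBits m)) (λ f → if b then ∏ (allBits d) (λ y → ω (f y)) else 1)
                 * (if b then c ^ 2 ^ d else 1)
               ≤ length (functions d (allBits m)) * (if b then c′ ^ 2 ^ d else 1)
  step false = ≤-reflexive (trans (cong (_* 1) (∑-const (functions d (allBits m)) 1))
                 (*-identityʳ _))
  step true = begin
    ∑ (functions d (allBits m)) (λ f → ∏ (allBits d) (λ y → ω (f y))) * c ^ 2 ^ d
      ≡⟨ cong (_* c ^ 2 ^ d) (∑-functions-∏ d (allBits m) (λ _ → ω)) ⟩
    ∏ (allBits d) (λ _ → ∑ (allBits m) ω) * c ^ 2 ^ d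
      ≡⟨ cong (_* c ^ 2 ^ d) (trans (∏-const (allBits d) _) (cong (∑ (allBits m) ω ^_) (length-allBits d))) ⟩
    ∑ (allBits m) ω ^ 2 ^ d * c ^ 2 ^ d
      ≡⟨ ^-distribʳ-* (∑ (allBits m) ω) c (2 ^ d) ⟨
    (∑ (allBits m) ω * c) ^ 2 ^ d
      ≤⟨ ^-monoˡ-≤ (2 ^ d) (subst (λ z → z * c ≤ 2 ^ m * c′) (sym (∑-if (allBits m) Y p q)) bound) ⟩
    (2 ^ m * c′) ^ 2 ^ d
      ≡⟨ ^-distribʳ-* (2 ^ m) c′ (2 ^ d) ⟩
    (2 ^ m) ^ 2 ^ d * c′ ^ 2 ^ d
      ≡⟨ cong (_* c′ ^ 2 ^ d) (trans (length-functions d (allBits m)) (cong (_^ 2 ^ d) (length-allBits m))) ⟨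
    length (functions d (allBits m)) * c′ ^ 2 ^ d ∎

-- isBad J E S Y says that #E(S,Y) / (D #S) ≥ #Y / M + 1/J.
isBad : ∀ {n d m} → ℕ → Graph n d m → Subset n → Subset m → Bool
isBad {n} {d} {m} J E S Y =
  card Y * (2 ^ d * card S) * J + 2 ^ m * (2 ^ d * card S) ≤ᵇ edgeCount E S Y * 2 ^ m * J

-- On a bad graph the weight with p = (h+1)^M, q = h^M exceeds its typical value by 2^G.
bad-weight-bound : ∀ h P a e w t G .{{_ : NonZero h}} →
  a + P ≤ e → 2 ^ G * h ^ P ≤ suc h ^ P → w * h ^ e ≡ suc h ^ e * t →
  suc h ^ a * 2 ^ G * t ≤ w * h ^ a
bad-weight-bound h P a e w t G a+P≤e 2^G≤ eq = *-cancelʳ-≤ _ _ (h ^ (P + r)) {{m^n≢0 h (P + r)}} (begin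
  suc h ^ a * 2 ^ G * t * h ^ (P + r)        ≡⟨ cong (suc h ^ a * 2 ^ G * t *_) (^-distribˡ-+-* h P r) ⟩
  suc h ^ a * 2 ^ G * t * (h ^ P * h ^ r)    ≡⟨ e₁ (suc h ^ a) (2 ^ G) t (h ^ P) (h ^ r) ⟩
  suc h ^ a * (2 ^ G * h ^ P * h ^ r) * t    ≤⟨ *-monoˡ-≤ t (*-monoʳ-≤ (suc h ^ a) (*-mono-≤ 2^G≤ (^-monoˡ-≤ r (n≤1+n h)))) ⟩
  suc h ^ a * (suc h ^ P * suc h ^ r) * t    ≡⟨ cong (_* t) (sym (split (suc h))) ⟩
  suc h ^ e * t                              ≡⟨ eq ⟨
  w * h ^ e                                  ≡⟨ cong (w *_) (split h) ⟩
  w * (h ^ a * (h ^ P * h ^ r))              ≡⟨ cong (λ z → w * (h ^ a * z)) (^-distribˡ-+-* h P r) ⟨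
  w * (h ^ a * h ^ (P + r))                  ≡⟨ *-assoc w (h ^ a) _ ⟨
  w * h ^ a * h ^ (P + r)                    ∎)
  where
  open ≤-Reasoning
  -- The surplus over the threshold; for it `h ^ r ≤ suc h ^ r` is enough.
  r = e ∸ (a + P)
  split : ∀ b → b ^ e ≡ b ^ a * (b ^ P * b ^ r)
  split b = trans (cong (b ^_) (trans (sym (m+[n∸m]≡n a+P≤e)) (+-assoc a P r)))
                  (trans (^-distribˡ-+-* b a (P + r)) (cong (b ^ a *_) (^-distribˡ-+-* b P r)))
  e₁ : ∀ a G t P r → a * G * t * (P * r) ≡ a * (G * P * r) * t
  e₁ = solve-∀

-- Markov's inequality for the weight. Relative to the reference value `(1 + 1/h)^a * t`, a bad
-- graph weighs at least `2 ^ G = 16 ^ γ`, while the average is at most `(1 + 1/R)^L ≤ 4 ^ γ`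
-- because `L = R * γ`. Hence the fraction of bad graphs is at most `4 ^ γ / 16 ^ γ`.
chernoff : ∀ {n d m} J g .{{_ : NonZero J}} → 2 ^ d ≡ 4 * J * (4 * J) * g → (S : Subset n) (Y : Subset m) →
  ∑ (graphs n d m) (λ E → indicator (isBad J E S Y)) * 4 ^ (g * card S) ≤ length (graphs n d m)
chernoff {n} {d} {m} J g 2^d≡ S Y = *-cancelʳ-≤ _ _ (4 ^ γ * R ^ L) {{m*n≢0 (4 ^ γ) (R ^ L)}} (begin
  B * 4 ^ γ * (4 ^ γ * R ^ L)          ≡⟨ e₀ B (4 ^ γ) (R ^ L) ⟩
  B * (4 ^ γ * 4 ^ γ) * R ^ L          ≡⟨ cong (λ z → B * z * R ^ L) 16^γ ⟩
  B * 2 ^ G * R ^ L                    ≤⟨ *-cancelʳ-≤ _ _ (suc h ^ a * t) {{m*n≢0 (suc h ^ a) t}} main ⟩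
  #Es * suc R ^ L                        ≤⟨ *-monoʳ-≤ #Es [1+R]^L ⟩
  #Es * (4 ^ γ * R ^ L)                  ∎)
  where
  open ≤-Reasoning
  M = 2 ^ m
  L = 2 ^ d * card S
  -- The moment parameter `1/κ` is a quarter of the accuracy `1/J`: the gain in the exponent is
  -- `L / (κ * J) = 4 * γ`, the loss only `L / R = γ`.
  κ = 4 * J
  R = κ * κ
  h = κ * M
  γ = g * card S
  G = 4 * γ
  -- Edge counts are scaled by `M` to keep thresholds integral: the mean `A * L / M` becomes `a`,
  -- and the excess `L / J` becomes `M * L / J`, which equals `h * G`. The multiple of `h` makes
  -- `(1 + 1/h)^P ≥ 2 ^ G` available.
  P = h * G
  A = card Y
  a = A * L
  #Es = length (graphs n d m)
  B = ∑ (graphs n d m) (λ E → indicator (isBad J E S Y))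
  W = weight {n} {d} {m} (suc h ^ M) (h ^ M) S Y
  t = (h ^ M) ^ L
  instance
    M≢0 : NonZero M
    M≢0 = m^n≢0 2 m
    κ≢0 : NonZero κ
    κ≢0 = m*n≢0 4 J
    R≢0 : NonZero R
    R≢0 = m*n≢0 κ κ
    h≢0 : NonZero h
    h≢0 = m*n≢0 κ M
    4^γ≢0 : NonZero (4 ^ γ)
    4^γ≢0 = m^n≢0 4 γ
    R^L≢0 : NonZero (R ^ L)
    R^L≢0 = m^n≢0 R L
    [1+h]^a≢0 : NonZero (suc h ^ a)
    [1+h]^a≢0 = m^n≢0 (suc h) a
    h^M≢0 : NonZero (h ^ M)
    h^M≢0 = m^n≢0 h M
    t≢0 : NonZero t
    t≢0 = m^n≢0 (h ^ M) L
  e₀ : ∀ b f r → b * f * (f * r) ≡ b * (f * f) * r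
  e₀ = solve-∀
  L≡Rγ : L ≡ R * γ
  L≡Rγ = trans (cong (_* card S) 2^d≡) (*-assoc R g (card S))
  16^γ : 4 ^ γ * 4 ^ γ ≡ 2 ^ G
  16^γ = trans (sym (^-distribʳ-* 4 4 γ)) (^-*-assoc 2 4 γ)
  [1+R]^L : suc R ^ L ≤ 4 ^ γ * R ^ L
  [1+R]^L = begin
    suc R ^ L              ≡⟨ trans (cong (suc R ^_) L≡Rγ) (sym (^-*-assoc (suc R) R γ)) ⟩
    (suc R ^ R) ^ γ        ≤⟨ ^-monoˡ-≤ γ ([1+h]^h≤4*h^h R) ⟩
    (4 * R ^ R) ^ γ        ≡⟨ ^-distribʳ-* 4 (R ^ R) γ ⟩
    4 ^ γ * (R ^ R) ^ γ    ≡⟨ cong (4 ^ γ *_) (trans (^-*-assoc R R γ) (cong (R ^_) (sym L≡Rγ))) ⟩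
    4 ^ γ * R ^ L          ∎
  2^G≤ : 2 ^ G * h ^ P ≤ suc h ^ P
  2^G≤ = begin
    2 ^ G * h ^ P          ≡⟨ cong (2 ^ G *_) (^-*-assoc h h G) ⟨
    2 ^ G * (h ^ h) ^ G    ≡⟨ ^-distribʳ-* 2 (h ^ h) G ⟨
    (2 * h ^ h) ^ G        ≤⟨ ^-monoˡ-≤ G (2*h^h≤[1+h]^h h) ⟩
    (suc h ^ h) ^ G        ≡⟨ ^-*-assoc (suc h) h G ⟩
    suc h ^ P              ∎
  P*J≡M*L : P * J ≡ M * L
  P*J≡M*L = trans (e₁ J M γ) (cong (M *_) (sym L≡Rγ))
    where
    e₁ : ∀ J M γ → 4 * J * M * (4 * γ) * J ≡ M * (4 * J * (4 * J) * γ)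
    e₁ = solve-∀
  bad⇒heavy : ∀ E → indicator (isBad J E S Y) * (suc h ^ a * 2 ^ G * t) ≤ W E * h ^ a
  bad⇒heavy E with isBad J E S Y in eq
  ... | false = z≤n
  ... | true  = ≤-trans (≤-reflexive (*-identityˡ _)) (bad-weight-bound h P a (M * X) (W E) t G a+P≤MX 2^G≤ weight≡)
    where
    X = edgeCount E S Y
    a+P≤MX : a + P ≤ M * X
    a+P≤MX = *-cancelʳ-≤ _ _ J (begin
      (a + P) * J        ≡⟨ *-distribʳ-+ J a P ⟩
      a * J + P * J      ≡⟨ cong (a * J +_) P*J≡M*L ⟩
      a * J + M * L      ≤⟨ ≤ᵇ⇒≤ _ _ (subst T (sym eq) tt) ⟩
      X * M * J          ≡⟨ cong (_* J) (*-comm X M) ⟩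
      M * X * J          ∎)
    weight≡ : W E * h ^ (M * X) ≡ suc h ^ (M * X) * t
    weight≡ = trans (cong (W E *_) (sym (^-*-assoc h M X)))
             (trans (weight-edgeCount (suc h ^ M) (h ^ M) S Y E) (cong (_* t) (^-*-assoc (suc h) M X)))
  c = h ^ A * R
  c′ = suc h ^ A * (suc R * h ^ M)
  main : B * 2 ^ G * R ^ L * (suc h ^ a * t) ≤ #Es * suc R ^ L * (suc h ^ a * t)
  main = begin
    B * 2 ^ G * R ^ L * (suc h ^ a * t)          ≡⟨ e₂ B (2 ^ G) (R ^ L) (suc h ^ a) t ⟩
    B * (suc h ^ a * 2 ^ G * t) * R ^ L          ≡⟨ cong (_* R ^ L) (∑-*ʳ (graphs n d m) _ _) ⟨
    ∑ (graphs n d m) (λ E → indicator (isBad J E S Y) * (suc h ^ a * 2 ^ G * t)) * R ^ L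
                                                 ≤⟨ *-monoˡ-≤ (R ^ L) (∑-mono (graphs n d m) bad⇒heavy) ⟩
    ∑ (graphs n d m) (λ E → W E * h ^ a) * R ^ L ≡⟨ cong (_* R ^ L) (∑-*ʳ (graphs n d m) W (h ^ a)) ⟩
    ∑ (graphs n d m) W * h ^ a * R ^ L           ≡⟨ *-assoc (∑ (graphs n d m) W) (h ^ a) (R ^ L) ⟩
    ∑ (graphs n d m) W * (h ^ a * R ^ L)
      ≡⟨ cong (∑ (graphs n d m) W *_) (trans (^-distribʳ-* (h ^ A) R L) (cong (_* R ^ L) (^-*-assoc h A L))) ⟨
    ∑ (graphs n d m) W * c ^ L
      ≤⟨ ∑-weight-bound {n} {d} {m} (suc h ^ M) (h ^ M) S Y c c′ (moment-bound κ M A (card (∁ Y)) (card+card-∁ Y)) ⟩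
    #Es * c′ ^ L
      ≡⟨ cong (#Es *_) (trans (^-distribʳ-* (suc h ^ A) (suc R * h ^ M) L)
                            (cong₂ _*_ (^-*-assoc (suc h) A L) (^-distribʳ-* (suc R) (h ^ M) L))) ⟩
    #Es * (suc h ^ a * (suc R ^ L * t))            ≡⟨ e₃ #Es (suc h ^ a) (suc R ^ L) t ⟩
    #Es * suc R ^ L * (suc h ^ a * t)              ∎
    where
    e₂ : ∀ b g r a t → b * g * r * (a * t) ≡ b * (a * g * t) * r
    e₂ = solve-∀
    e₃ : ∀ T a r t → T * (a * (r * t)) ≡ T * r * (a * t)
    e₃ = solve-∀

-- The union bound

-- Every prefix has the same number of extensions, so a test on prefixes keeps its density when it
-- is read as a test on full outputs.
card-takeLE : ∀ {m} j (j≤m : j ≤ m) (Y : Subset j) → card (Y ∘ takeLE j j≤m) ≡ card Y * 2 ^ (m ∸ j)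
card-takeLE {m} zero _ Y = begin
  ∑ (allBits m) (λ _ → indicator (Y []))    ≡⟨ ∑-const (allBits m) _ ⟩
  length (allBits m) * indicator (Y [])     ≡⟨ cong (_* indicator (Y [])) (length-allBits m) ⟩
  2 ^ m * indicator (Y [])                  ≡⟨ *-comm (2 ^ m) _ ⟩
  indicator (Y []) * 2 ^ m                  ≡⟨ cong (_* 2 ^ m) (+-identityʳ (indicator (Y []))) ⟨
  (indicator (Y []) + 0) * 2 ^ m            ∎
  where open ≡-Reasoning
card-takeLE {suc m} (suc j) (s≤s j≤m) Y = begin
  card (Y ∘ takeLE (suc j) (s≤s j≤m))
    ≡⟨ ∑-allBits m _ ⟩
  card (Y ∘ (true ∷_) ∘ takeLE j j≤m) + card (Y ∘ (false ∷_) ∘ takeLE j j≤m)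
    ≡⟨ cong₂ _+_ (card-takeLE j j≤m (Y ∘ (true ∷_))) (card-takeLE j j≤m (Y ∘ (false ∷_))) ⟩
  card (Y ∘ (true ∷_)) * 2 ^ (m ∸ j) + card (Y ∘ (false ∷_)) * 2 ^ (m ∸ j)
    ≡⟨ *-distribʳ-+ (2 ^ (m ∸ j)) (card (Y ∘ (true ∷_))) _ ⟨
  (card (Y ∘ (true ∷_)) + card (Y ∘ (false ∷_))) * 2 ^ (m ∸ j)
    ≡⟨ cong (_* 2 ^ (m ∸ j)) (∑-allBits j (indicator ∘ Y)) ⟨
  card Y * 2 ^ (m ∸ j) ∎
  where open ≡-Reasoning

-- The binomial theorem: a point contributes 1 if it lies in `S` and `c` otherwise. With
-- `c = N = 2 ^ n` this is the sum of `N^(-#S)` multiplied by `N ^ N`, which keeps exponents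
-- natural.
∑-subsets-^ : ∀ n c → ∑ (subsets n) (λ S → c ^ card (∁ S)) ≡ suc c ^ 2 ^ n
∑-subsets-^ n c = begin
  ∑ (subsets n) (λ S → c ^ card (∁ S))
    ≡⟨ ∑-cong (subsets n) (λ S → sym (∏-^ (allBits n) c (indicator ∘ ∁ S))) ⟩
  ∑ (subsets n) (λ S → ∏ (allBits n) (λ x → c ^ indicator (not (S x))))
    ≡⟨ ∑-functions-∏ n bools (λ _ b → c ^ indicator (not b)) ⟩
  ∏ (allBits n) (λ _ → suc (c * 1 + 0))
    ≡⟨ ∏-const (allBits n) _ ⟩
  suc (c * 1 + 0) ^ length (allBits n)
    ≡⟨ cong₂ (λ c → suc c ^_) (trans (+-identityʳ _) (*-identityʳ c)) (length-allBits n) ⟩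
  suc c ^ 2 ^ n ∎
  where open ≡-Reasoning

-- Since ∑_S N^(-#S) = (1 + 1/N)^N is bounded, a decay of 1 / (C N^#S) survives the sum over all S.
∑-subsets-bound : ∀ n (f : Subset n → ℕ) C T → (∀ S → f S * (C * (2 ^ n) ^ card S) ≤ T) →
  ∑ (subsets n) f * C ≤ 4 * T
∑-subsets-bound n f C T bound = *-cancelʳ-≤ _ _ (N ^ N) {{m^n≢0 N N}} (begin
  ∑ (subsets n) f * C * N ^ N                      ≡⟨ *-assoc (∑ (subsets n) f) C (N ^ N) ⟩
  ∑ (subsets n) f * (C * N ^ N)                    ≡⟨ ∑-*ʳ (subsets n) f _ ⟨
  ∑ (subsets n) (λ S → f S * (C * N ^ N))          ≤⟨ ∑-mono (subsets n) step ⟩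
  ∑ (subsets n) (λ S → N ^ card (∁ S) * T)         ≡⟨ ∑-*ʳ (subsets n) _ T ⟩
  ∑ (subsets n) (λ S → N ^ card (∁ S)) * T         ≡⟨ cong (_* T) (∑-subsets-^ n N) ⟩
  suc N ^ N * T                                    ≤⟨ *-monoˡ-≤ T ([1+h]^h≤4*h^h N) ⟩
  4 * N ^ N * T                                    ≡⟨ e₂ (N ^ N) T ⟩
  4 * T * N ^ N                                    ∎)
  where
  open ≤-Reasoning
  N = 2 ^ n
  instance
    N≢0 : NonZero N
    N≢0 = m^n≢0 2 n
  e₁ : ∀ f C p q → f * (C * (p * q)) ≡ q * (f * (C * p))
  e₁ = solve-∀
  e₂ : ∀ p T → 4 * p * T ≡ 4 * T * p
  e₂ = solve-∀
  step : ∀ S → f S * (C * N ^ N) ≤ N ^ card (∁ S) * T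
  step S = begin
    f S * (C * N ^ N)                              ≡⟨ cong (λ e → f S * (C * N ^ e)) (card+card-∁ S) ⟨
    f S * (C * N ^ (card S + card (∁ S)))          ≡⟨ cong (λ z → f S * (C * z)) (^-distribˡ-+-* N (card S) _) ⟩
    f S * (C * (N ^ card S * N ^ card (∁ S)))      ≡⟨ e₁ (f S) C (N ^ card S) (N ^ card (∁ S)) ⟩
    N ^ card (∁ S) * (f S * (C * N ^ card S))      ≤⟨ *-monoʳ-≤ (N ^ card (∁ S)) (bound S) ⟩
    N ^ card (∁ S) * T                             ∎

n<2^n : ∀ n → n < 2 ^ n
n<2^n zero    = z<s
n<2^n (suc n) = begin-strict
  suc n            ≡⟨ +-comm 1 n ⟩
  n + 1            <⟨ +-mono-<-≤ (n<2^n n) (m^n>0 2 n) ⟩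
  2 ^ n + 2 ^ n    ≡⟨ cong (2 ^ n +_) (+-identityʳ (2 ^ n)) ⟨
  2 ^ suc n        ∎
  where open ≤-Reasoning

isBad-cong : ∀ {n d m} J (E : Graph n d m) {S S′ Y Y′} → S ≗ S′ → Y ≗ Y′ → isBad J E S Y ≡ isBad J E S′ Y′
isBad-cong {n} {d} {m} J E S≗ Y≗ = cong₃ (card-cong Y≗) (card-cong S≗) (edgeCount-cong E S≗ Y≗)
  where
  cong₃ : ∀ {a a′ s s′ x x′} → a ≡ a′ → s ≡ s′ → x ≡ x′ →
          (a * (2 ^ d * s) * J + 2 ^ m * (2 ^ d * s) ≤ᵇ x * 2 ^ m * J) ≡
          (a′ * (2 ^ d * s′) * J + 2 ^ m * (2 ^ d * s′) ≤ᵇ x′ * 2 ^ m * J)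
  cong₃ refl refl refl = refl

-- Pulling tests back to the full output lets one random graph serve all truncations: the edge
-- counts of `truncOut i E` against `Y` and of `E` against `liftTest i Y` agree by definition.
liftTest : ∀ {m} i → Subset (m ∸ i) → Subset m
liftTest {m} i Y = Y ∘ takeLE (m ∸ i) (m∸n≤m m i)

-- The parameters without logarithms: for accuracy `ε = 1/J`, the number `g` is `D ε² / 16`, and the
-- last hypothesis expresses `m = k + log n` together with its truncations.
module UnionBound {n k d m : ℕ} (0<n : 0 < n) (k≤n : k ≤ n) (J g : ℕ) {{J≢0 : NonZero J}}
  (2^d≡ : 2 ^ d ≡ 4 * J * (4 * J) * g) (4n≤g : 4 * n ≤ g)
  (2^[m∸i]≡ : ∀ {i} → i ≤ k → 2 ^ (m ∸ i) ≡ 2 ^ (k ∸ i) * n) where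

  open ≤-Reasoning

  private
    Es = graphs n d m
    #Es = length Es

  isBadFor : ∀ i → Graph n d m → Subset n → Subset (m ∸ i) → ℕ
  isBadFor i E S Y = indicator (2 ^ (k ∸ i) ≤ᵇ card S) * indicator (isBad J E S (liftTest i Y))

  failures : Graph n d m → ℕ
  failures E = ∑ (allFin (suc k)) λ i → ∑ (subsets n) λ S → ∑ (subsets (m ∸ toℕ i)) (isBadFor (toℕ i) E S)

  -- The budget of the union bound. The Chernoff exponent is at least `8 * n * s`. One `n * s` pays
  -- for the tests, since `2 ^ (m ∸ i) = 2 ^ (k ∸ i) * n ≤ n * s`; another pays for the sum over the
  -- sets; `6 * n` is kept for the truncations.
  exponent-bound : ∀ {i s} → i ≤ k → 2 ^ (k ∸ i) ≤ s → 6 * n + n * s + 2 ^ (m ∸ i) ≤ 2 * (g * s)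
  exponent-bound {i} {s} i≤k K≤s = begin
    6 * n + n * s + 2 ^ (m ∸ i)          ≡⟨ cong (6 * n + n * s +_) (trans (2^[m∸i]≡ i≤k) (*-comm (2 ^ (k ∸ i)) n)) ⟩
    6 * n + n * s + n * 2 ^ (k ∸ i)      ≤⟨ +-mono-≤ (+-monoˡ-≤ (n * s) (*-monoʳ-≤ 6 n≤ns)) (*-monoʳ-≤ n K≤s) ⟩
    6 * (n * s) + n * s + n * s          ≡⟨ e₁ n s ⟩
    2 * (4 * n * s)                      ≤⟨ *-monoʳ-≤ 2 (*-monoˡ-≤ s 4n≤g) ⟩
    2 * (g * s)                          ∎
    where
    e₁ : ∀ n s → 6 * (n * s) + n * s + n * s ≡ 2 * (4 * n * s)
    e₁ = solve-∀
    n≤ns : n ≤ n * s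
    n≤ns = ≤-trans (≤-reflexive (sym (*-identityʳ n))) (*-monoʳ-≤ n (≤-trans (m^n>0 2 (k ∸ i)) K≤s))

  -- A union bound over the `2 ^ 2 ^ (m ∸ i)` tests for a fixed `S`. The decay that survives has the
  -- form required by `∑-subsets-bound` with `C = 2 ^ (6 * n)`.
  failures-per-set : ∀ {i} → i ≤ k → ∀ S →
    ∑ (subsets (m ∸ i)) (λ Y → ∑ Es (λ E → isBadFor i E S Y)) * (2 ^ (6 * n) * (2 ^ n) ^ card S) ≤ #Es
  failures-per-set {i} i≤k S with 2 ^ (k ∸ i) ≤ᵇ card S in eq
  -- Sets below the size threshold contribute no failures.
  ... | false = ≤-trans (≤-reflexive (cong (_* (2 ^ (6 * n) * (2 ^ n) ^ card S)) all-zero)) z≤n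
    where
    all-zero : ∑ (subsets (m ∸ i)) (λ Y → ∑ Es (λ E → 0)) ≡ 0
    all-zero = trans (∑-cong (subsets (m ∸ i)) (λ _ → ∑-0 Es)) (∑-0 (subsets (m ∸ i)))
  ... | true  = *-cancelʳ-≤ _ _ (2 ^ Mᵢ) {{m^n≢0 2 Mᵢ}} (begin
    Z * (2 ^ (6 * n) * (2 ^ n) ^ s) * 2 ^ Mᵢ     ≡⟨ *-assoc Z _ (2 ^ Mᵢ) ⟩
    Z * (2 ^ (6 * n) * (2 ^ n) ^ s * 2 ^ Mᵢ)     ≡⟨ cong (Z *_) powers ⟨
    Z * 2 ^ (6 * n + n * s + Mᵢ)                 ≤⟨ *-monoʳ-≤ Z (^-monoʳ-≤ 2 (exponent-bound i≤k K≤s)) ⟩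
    Z * 2 ^ (2 * (g * s))                        ≡⟨ cong (Z *_) (^-*-assoc 2 2 (g * s)) ⟨
    Z * 4 ^ (g * s)                              ≡⟨ ∑-*ʳ (subsets (m ∸ i)) _ _ ⟨
    ∑ (subsets (m ∸ i)) (λ Y → ∑ Es (λ E → 1 * bad E Y) * 4 ^ (g * s))
      ≤⟨ ∑-mono (subsets (m ∸ i)) per-test ⟩
    ∑ (subsets (m ∸ i)) (λ _ → #Es)                ≡⟨ ∑-const (subsets (m ∸ i)) #Es ⟩
    length (subsets (m ∸ i)) * #Es                 ≡⟨ cong (_* #Es) (length-functions (m ∸ i) bools) ⟩
    2 ^ Mᵢ * #Es                                   ≡⟨ *-comm (2 ^ Mᵢ) #Es ⟩
    #Es * 2 ^ Mᵢ                                   ∎)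
    where
    s = card S
    Mᵢ = 2 ^ (m ∸ i)
    bad : Graph n d m → Subset (m ∸ i) → ℕ
    bad E Y = indicator (isBad J E S (liftTest i Y))
    Z = ∑ (subsets (m ∸ i)) (λ Y → ∑ Es (λ E → 1 * bad E Y))
    K≤s : 2 ^ (k ∸ i) ≤ s
    K≤s = ≤ᵇ⇒≤ _ _ (subst T (sym eq) tt)
    per-test : ∀ Y → ∑ Es (λ E → 1 * bad E Y) * 4 ^ (g * s) ≤ #Es
    per-test Y = ≤-trans (≤-reflexive (cong (_* 4 ^ (g * s)) (∑-cong Es (λ E → *-identityˡ _))))
                         (chernoff {n} {d} {m} J g 2^d≡ S (liftTest i Y))
    powers : 2 ^ (6 * n + n * s + Mᵢ) ≡ 2 ^ (6 * n) * (2 ^ n) ^ s * 2 ^ Mᵢ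
    powers = trans (^-distribˡ-+-* 2 (6 * n + n * s) Mᵢ)
      (cong (_* 2 ^ Mᵢ) (trans (^-distribˡ-+-* 2 (6 * n) (n * s)) (cong (2 ^ (6 * n) *_) (sym (^-*-assoc 2 n s)))))

  ∑-failures : ∑ Es failures ≡
    ∑ (allFin (suc k)) λ i → ∑ (subsets n) λ S → ∑ (subsets (m ∸ toℕ i)) λ Y → ∑ Es λ E → isBadFor (toℕ i) E S Y
  ∑-failures = trans (∑-swap Es (allFin (suc k)) _) (∑-cong (allFin (suc k)) λ i →
               trans (∑-swap Es (subsets n) _) (∑-cong (subsets n) λ S →
               ∑-swap Es (subsets (m ∸ toℕ i)) _))

  few-failures : ∑ Es failures < #Es
  few-failures = *-cancelʳ-< (2 ^ (6 * n)) _ _ (begin-strict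
    ∑ Es failures * 2 ^ (6 * n)                  ≡⟨ cong (_* 2 ^ (6 * n)) ∑-failures ⟩
    ∑ (allFin (suc k)) F * 2 ^ (6 * n)           ≡⟨ ∑-*ʳ (allFin (suc k)) F (2 ^ (6 * n)) ⟨
    ∑ (allFin (suc k)) (λ i → F i * 2 ^ (6 * n))
      ≤⟨ ∑-mono (allFin (suc k)) (λ i → ∑-subsets-bound n _ (2 ^ (6 * n)) #Es (failures-per-set (toℕ≤pred[n] i))) ⟩
    ∑ (allFin (suc k)) (λ _ → 4 * #Es)             ≡⟨ ∑-const (allFin (suc k)) (4 * #Es) ⟩
    length (allFin (suc k)) * (4 * #Es)            ≡⟨ cong (_* (4 * #Es)) (length-tabulate {n = suc k} id) ⟩
    -- There are `k + 1 ≤ 2 ^ n` truncations; with the factor 4 they cost `2 ^ (n + 2)`, strictly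
    -- less than the reserve `2 ^ (6 * n)` because `0 < n`.
    suc k * (4 * #Es)                              ≤⟨ *-monoˡ-≤ (4 * #Es) (≤-trans (s≤s k≤n) (n<2^n n)) ⟩
    2 ^ n * (4 * #Es)                              ≡⟨ e₁ (2 ^ n) #Es ⟩
    #Es * (2 ^ n * 4)                              ≡⟨ cong (#Es *_) (^-distribˡ-+-* 2 n 2) ⟨
    #Es * 2 ^ (n + 2)                              <⟨ *-monoʳ-< #Es (^-monoʳ-< 2 (s≤s (s≤s z≤n)) n+2<6n) ⟩
    #Es * 2 ^ (6 * n)                              ∎)
    where
    F : Fin (suc k) → ℕ
    F i = ∑ (subsets n) λ S → ∑ (subsets (m ∸ toℕ i)) λ Y → ∑ Es λ E → isBadFor (toℕ i) E S Y
    e₁ : ∀ N T → N * (4 * T) ≡ T * (N * 4)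
    e₁ = solve-∀
    n+2<6n : n + 2 < 6 * n
    n+2<6n = +-monoʳ-< n (<-≤-trans (s≤s (s≤s (s≤s z≤n))) (*-monoʳ-≤ 5 0<n))
    instance
      #Es≢0 : NonZero #Es
      #Es≢0 = subst NonZero (sym (trans (length-functions n (functions d (allBits m)))
              (cong (_^ 2 ^ n) (trans (length-functions d (allBits m)) (cong (_^ 2 ^ d) (length-allBits m))))))
              (m^n≢0 _ (2 ^ n) {{m^n≢0 _ (2 ^ d) {{m^n≢0 2 m}}}})

  ∃-good : ∃ λ (E : Graph n d m) → ∀ {i} → i ≤ k → ∀ S Y → 2 ^ (k ∸ i) ≤ card S →
             isBad J E S (liftTest i Y) ≡ false
  ∃-good with E , none ← ∑<length⇒∃≡0 Es failures few-failures = E , good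
    where
    good : ∀ {i} → i ≤ k → ∀ S Y → 2 ^ (k ∸ i) ≤ card S → isBad J E S (liftTest i Y) ≡ false
    good {i} i≤k S Y K≤s
      with S′ , S′∈ , S′≗ ← subsets-complete S
         | Y′ , Y′∈ , Y′≗ ← subsets-complete Y =
      trans (sym (isBad-cong J E S′≗ (λ v → Y′≗ (takeLE (m ∸ i) (m∸n≤m m i) v))))
            (none-bad (≤⇒≤ᵇ K≤s′) (n≤0⇒n≡0 term≤0))
      where
      i′ = fromℕ< (s≤s i≤k)
      K≤s′ : 2 ^ (k ∸ i) ≤ card S′
      K≤s′ = subst (2 ^ (k ∸ i) ≤_) (sym (card-cong S′≗)) K≤s
      ∑≤0 : ∑ (subsets n) (λ S → ∑ (subsets (m ∸ i)) (isBadFor i E S)) ≤ 0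
      ∑≤0 = subst₂ (λ j f → ∑ (subsets n) (λ S → ∑ (subsets (m ∸ j)) (isBadFor j E S)) ≤ f)
        (toℕ-fromℕ< (s≤s i≤k)) none (∈⇒≤∑ _ (∈-allFin i′))
      term≤0 : isBadFor i E S′ Y′ ≤ 0
      term≤0 = ≤-trans (∈⇒≤∑ (isBadFor i E S′) Y′∈) (≤-trans (∈⇒≤∑ _ S′∈) ∑≤0)
      none-bad : ∀ {b c} → T b → indicator b * indicator c ≡ 0 → c ≡ false
      none-bad {true} {false} _ _ = refl

-- Clearing denominators in the extractor inequality

open import Data.Integer as ℤ using (ℤ; +_; -[1+_]; ∣_∣; _⊖_)
import Data.Integer.Properties as ℤ
open import Data.Rational as ℚ using (ℚ; mkℚ; 0ℚ; toℚᵘ; ↥_; ↧ₙ_)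
import Data.Rational.Properties as ℚ
open import Data.Rational.Unnormalised as ℚᵘ using (mkℚᵘ; *<*; *≡*)
import Data.Rational.Unnormalised.Properties as ℚᵘ

toℚᵘ-nat : ∀ a → toℚᵘ (nat a) ℚᵘ.≃ mkℚᵘ (+ a) 0
toℚᵘ-nat a = ℚ.toℚᵘ-fromℚᵘ (mkℚᵘ (+ a) 0)

-- Moves the parameter equations from ℚ to ℕ. Positivity of `ε2` identifies its numerator with the
-- absolute value.
*-nat-numerators : ∀ ε2 a c → ε2 ℚ.* nat a ≡ nat c → 0ℚ ℚ.< ε2 → ∣ ↥ ε2 ∣ * a ≡ c * ↧ₙ ε2
*-nat-numerators ε2@(mkℚ -[1+ _ ] _ _) a c eq (ℚ.*<* ())
*-nat-numerators ε2@(mkℚ (+ p) q-1 _) a c eq _ = ℤ.+-injective (begin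
  + (p * a)                 ≡⟨ ℤ.pos-* p a ⟩
  + p ℤ.* + a               ≡⟨ ℤ.*-identityʳ _ ⟨
  + p ℤ.* + a ℤ.* + 1       ≡⟨ ℚᵘ.drop-*≡* unnormalised ⟩
  + c ℤ.* + suc (q-1 * 1)   ≡⟨ cong (λ z → + c ℤ.* + suc z) (*-identityʳ q-1) ⟩
  + c ℤ.* + suc q-1         ≡⟨ ℤ.pos-* c (suc q-1) ⟨
  + (c * suc q-1)           ∎)
  where
  open ≡-Reasoning
  unnormalised : mkℚᵘ (+ p) q-1 ℚᵘ.* mkℚᵘ (+ a) 0 ℚᵘ.≃ mkℚᵘ (+ c) 0
  unnormalised = ℚᵘ.≃-trans (ℚᵘ.*-congˡ {mkℚᵘ (+ p) q-1} (ℚᵘ.≃-sym (toℚᵘ-nat a)))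
    (ℚᵘ.≃-trans (ℚᵘ.≃-sym (ℚ.toℚᵘ-homo-* ε2 (nat a)))
    (ℚᵘ.≃-trans (ℚ.toℚᵘ-cong eq) (toℚᵘ-nat c)))

nat-* : ∀ a b → nat a ℚ.* nat b ≡ nat (a * b)
nat-* a b = ℚ.toℚᵘ-injective (ℚᵘ.≃-trans (ℚ.toℚᵘ-homo-* (nat a) (nat b))
  (ℚᵘ.≃-trans (ℚᵘ.*-cong (toℚᵘ-nat a) (toℚᵘ-nat b))
  (ℚᵘ.≃-trans (*≡* (cong (ℤ._* + 1) (sym (ℤ.pos-* a b)))) (ℚᵘ.≃-sym (toℚᵘ-nat (a * b))))))

∣⊖∣*-< : ∀ u v J B .{{_ : NonZero B}} → u * J < v * J + B → v * J < u * J + B → ∣ u ⊖ v ∣ * J < B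
∣⊖∣*-< u v J B u< v< with ≤-total u v
... | inj₁ u≤v = begin-strict
  ∣ u ⊖ v ∣ * J    ≡⟨ cong (_* J) (ℤ.∣⊖∣-≤ u≤v) ⟩
  (v ∸ u) * J      ≡⟨ *-distribʳ-∸ J v u ⟩
  v * J ∸ u * J    <⟨ m<n+o⇒m∸n<o (v * J) (u * J) v< ⟩
  B                ∎
  where open ≤-Reasoning
... | inj₂ v≤u = begin-strict
  ∣ u ⊖ v ∣ * J    ≡⟨ cong (_* J) (trans (ℤ.∣m⊖n∣≡∣n⊖m∣ u v) (ℤ.∣⊖∣-≤ v≤u)) ⟩
  (u ∸ v) * J      ≡⟨ *-distribʳ-∸ J u v ⟩
  u * J ∸ v * J    <⟨ m<n+o⇒m∸n<o (u * J) (v * J) u< ⟩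
  B                ∎
  where open ≤-Reasoning

square≡ : ∀ z → z ℤ.* z ≡ + (∣ z ∣ * ∣ z ∣)
square≡ (+ n)    = sym (ℤ.pos-* n n)
square≡ -[1+ n ] = refl

-- |x/L - A/M| < 1/J and 1/J² ≤ ε² give the squared form of the extractor inequality.
square-bound : ∀ x L A M J ε2 .{{_ : NonZero L}} .{{_ : NonZero M}} → 0ℚ ℚ.< ε2 →
  x * M * J < A * L * J + L * M → A * L * J < x * M * J + L * M → ↧ₙ ε2 ≤ ∣ ↥ ε2 ∣ * (J * J) →
  let δ = (x over L) ℚ.- (A over M) in δ ℚ.* δ ℚ.< ε2
square-bound x L A M J ε2@(mkℚ -[1+ _ ] _ _) (ℚ.*<* ())
square-bound x (suc l) A (suc m) J ε2@(mkℚ (+ p) q-1 _) 0<ε2 upper lower q≤pJ² =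
  ℚ.toℚᵘ-cancel-< (ℚᵘ.<-respˡ-≃ (ℚᵘ.≃-sym δ²≃) (*<* (begin-strict
    z ℤ.* z ℤ.* + q                  ≡⟨ cong (ℤ._* + q) (square≡ z) ⟩
    + (w * w) ℤ.* + q                ≡⟨ ℤ.pos-* (w * w) q ⟨
    + (w * w * q)                    <⟨ ℤ.+<+ key ⟩
    + (p * (suc l * suc m * (suc l * suc m))) ≡⟨ ℤ.pos-* p _ ⟩
    + p ℤ.* + (suc l * suc m * (suc l * suc m)) ∎)))
  where
  open ℤ.≤-Reasoning
  q = suc q-1
  -- The numerator of the difference over the denominator `suc l * suc m`. Unnormalised rationals
  -- keep both visible, whereas ℚ reduces fractions.
  z = + x ℤ.* + suc m ℤ.+ ℤ.- (+ A) ℤ.* + suc l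
  w = ∣ z ∣
  δᵘ = mkℚᵘ (+ x) l ℚᵘ.+ ℚᵘ.- mkℚᵘ (+ A) m
  δ²≃ : toℚᵘ (((x over suc l) ℚ.- (A over suc m)) ℚ.* ((x over suc l) ℚ.- (A over suc m))) ℚᵘ.≃ δᵘ ℚᵘ.* δᵘ
  δ²≃ = ℚᵘ.≃-trans (ℚ.toℚᵘ-homo-* δ δ) (ℚᵘ.*-cong δ≃ δ≃)
    where
    δ = (x over suc l) ℚ.- (A over suc m)
    δ≃ : toℚᵘ δ ℚᵘ.≃ δᵘ
    δ≃ = ℚᵘ.≃-trans (ℚ.toℚᵘ-homo-+ (x over suc l) (ℚ.- (A over suc m)))
      (ℚᵘ.+-cong (ℚ.toℚᵘ-fromℚᵘ (mkℚᵘ (+ x) l))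
        (ℚᵘ.≃-trans (ℚ.toℚᵘ-homo‿- (A over suc m)) (ℚᵘ.-‿cong (ℚ.toℚᵘ-fromℚᵘ (mkℚᵘ (+ A) m)))))
  z≡ : z ≡ (x * suc m) ⊖ (A * suc l)
  z≡ = trans (cong₂ ℤ._+_ (sym (ℤ.pos-* x (suc m)))
               (trans (sym (ℤ.neg-distribˡ-* (+ A) (+ suc l))) (cong ℤ.-_ (sym (ℤ.pos-* A (suc l))))))
             (ℤ.m-n≡m⊖n (x * suc m) (A * suc l))
  wJ<LM : w * J < suc l * suc m
  wJ<LM = subst (λ z → ∣ z ∣ * J < suc l * suc m) (sym z≡)
    (∣⊖∣*-< (x * suc m) (A * suc l) J (suc l * suc m) upper lower)
  key : w * w * q < p * (suc l * suc m * (suc l * suc m))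
  key = ≤-<-trans (*-monoʳ-≤ (w * w) q≤pJ²)
    (subst (_< p * (suc l * suc m * (suc l * suc m))) (rearrange w p J)
      (*-monoʳ-< p {{p≢0 p q≤pJ²}} (*-mono-< wJ<LM wJ<LM)))
    where
    rearrange : ∀ w p J → p * (w * J * (w * J)) ≡ w * w * (p * (J * J))
    rearrange = solve-∀
    -- A positive `p` is needed to keep the squared inequality strict; it follows from
    -- `1 ≤ q ≤ p * (J * J)`.
    p≢0 : ∀ p → q ≤ p * (J * J) → NonZero p
    p≢0 (suc _) _ = _

-- From one-sided bounds to prefix extractors

-- #E(S,Y) / (D #S) < #Y / M + 1/J, with denominators cleared
Upper : ∀ {n d m} → ℕ → Graph n d m → Subset n → Subset m → Set
Upper {n} {d} {m} J E S Y =
  edgeCount E S Y * 2 ^ m * J < card Y * (2 ^ d * card S) * J + 2 ^ d * card S * 2 ^ m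

-- The densities of `Y` and `∁ Y` add up to 1, on the right side as well as among the edges, so
-- their deviations are opposite. Hence one-sided bounds for all tests suffice.
upper-∁⇒lower : ∀ {n d m} J (E : Graph n d m) S Y → Upper J E S (∁ Y) →
  card Y * (2 ^ d * card S) * J < edgeCount E S Y * 2 ^ m * J + 2 ^ d * card S * 2 ^ m
upper-∁⇒lower {n} {d} {m} J E S Y upper =
  +-cancelʳ-< (X′ * M * J) _ _ (begin-strict
    A * L * J + X′ * M * J                       <⟨ +-monoʳ-< (A * L * J) upper ⟩
    A * L * J + (A′ * L * J + L * M)             ≡⟨ e₁ A A′ L J M ⟩
    (A + A′) * L * J + L * M                     ≡⟨ cong (λ z → z * L * J + L * M) (card+card-∁ Y) ⟩
    M * L * J + L * M                            ≡⟨ cong (λ z → M * z * J + L * M) (edgeCount+edgeCount-∁ E S Y) ⟨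
    M * (X + X′) * J + L * M                     ≡⟨ e₂ X X′ M J (L * M) ⟩
    X * M * J + L * M + X′ * M * J               ∎)
  where
  open ≤-Reasoning
  M = 2 ^ m
  L = 2 ^ d * card S
  A = card Y
  A′ = card (∁ Y)
  X = edgeCount E S Y
  X′ = edgeCount E S (∁ Y)
  e₁ : ∀ A A′ L J M → A * L * J + (A′ * L * J + L * M) ≡ (A + A′) * L * J + L * M
  e₁ = solve-∀
  e₂ : ∀ X X′ M J z → M * (X + X′) * J + z ≡ X * M * J + z + X′ * M * J
  e₂ = solve-∀

∈-allBits : ∀ {a} (v : Vec Bool a) → v ∈ allBits a
∈-allBits []                  = here refl
∈-allBits (true ∷ v)          = ∈-++⁺ˡ (∈-map⁺ (true ∷_) (∈-allBits v))
∈-allBits {suc a} (false ∷ v) = ∈-++⁺ʳ (map (true ∷_) (allBits a)) (∈-map⁺ (false ∷_) (∈-allBits v))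

edgeCount-empty : ∀ {n d m} (E : Graph n d m) S Y → card Y ≡ 0 → edgeCount E S Y ≡ 0
edgeCount-empty {n} {d} E S Y #Y≡0 = trans (∑-cong (allBits n) (λ x → lemma x (S x))) (∑-0 (allBits n))
  where
  ∉Y : ∀ v → indicator (Y v) ≡ 0
  ∉Y v = n≤0⇒n≡0 (subst (indicator (Y v) ≤_) #Y≡0 (∈⇒≤∑ (indicator ∘ Y) (∈-allBits v)))
  lemma : ∀ x b → (if b then ∑ (allBits d) (λ y → indicator (Y (E x y))) else 0) ≡ 0
  lemma x true  = trans (∑-cong (allBits d) (λ y → ∉Y (E x y))) (∑-0 (allBits d))
  lemma x false = refl

-- The edge density is at most 1, which alone gives only a weak inequality. Strictness comes from
-- `card Y > 0`, or, when `Y` is empty, from the absence of edges.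
upper-1 : ∀ {n d m} (E : Graph n d m) S Y → 0 < card S → Upper 1 E S Y
upper-1 {n} {d} {m} E S Y 0<s with card Y in #Y
... | zero  = subst (λ x → x * M * 1 < L * M) (sym (edgeCount-empty E S Y #Y)) (*-mono-< 0<L (m^n>0 2 m))
  where
  M = 2 ^ m
  L = 2 ^ d * card S
  0<L : 0 < L
  0<L = *-mono-< (m^n>0 2 d) 0<s
... | suc c = begin-strict
  edgeCount E S Y * M * 1       ≡⟨ *-identityʳ _ ⟩
  edgeCount E S Y * M           ≤⟨ *-monoˡ-≤ M (subst (edgeCount E S Y ≤_) (edgeCount+edgeCount-∁ E S Y) (m≤m+n _ _)) ⟩
  L * M                         <⟨ m<n+m (L * M) (*-mono-< (*-mono-< {x = 0} {y = suc c} z<s 0<L) (z<s {0})) ⟩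
  suc c * L * 1 + L * M         ∎
  where
  open ≤-Reasoning
  M = 2 ^ m
  L = 2 ^ d * card S
  0<L : 0 < L
  0<L = *-mono-< (m^n>0 2 d) 0<s

-- Both sides of the inequality for the lifted test carry the factor `r`, the number of extensions
-- of a prefix, and it cancels.
¬isBad⇒upper : ∀ {n d m} J (E : Graph n d m) S i (Y : Subset (m ∸ i)) →
  isBad J E S (liftTest i Y) ≡ false → Upper J (truncOut i E) S Y
¬isBad⇒upper {n} {d} {m} J E S i Y ¬bad = *-cancelʳ-< r _ _ (begin-strict
  X * Mᵢ * J * r                       ≡⟨ e₁ X Mᵢ J r ⟩
  X * (Mᵢ * r) * J                     ≡⟨ cong (λ z → X * z * J) Mᵢr≡M ⟩
  X * M * J                            <⟨ ≰⇒> (λ le → subst T ¬bad (≤⇒≤ᵇ le)) ⟩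
  card (liftTest i Y) * L * J + M * L  ≡⟨ cong₂ (λ a z → a * L * J + z * L) (card-takeLE (m ∸ i) (m∸n≤m m i) Y) (sym Mᵢr≡M) ⟩
  card Y * r * L * J + Mᵢ * r * L      ≡⟨ e₂ (card Y) r L J Mᵢ ⟩
  (card Y * L * J + L * Mᵢ) * r        ∎)
  where
  open ≤-Reasoning
  X = edgeCount (truncOut i E) S Y
  L = 2 ^ d * card S
  M = 2 ^ m
  Mᵢ = 2 ^ (m ∸ i)
  r = 2 ^ (m ∸ (m ∸ i))
  Mᵢr≡M : Mᵢ * r ≡ M
  Mᵢr≡M = trans (sym (^-distribˡ-+-* 2 (m ∸ i) (m ∸ (m ∸ i)))) (cong (2 ^_) (m+[n∸m]≡n (m∸n≤m m i)))
  e₁ : ∀ X M J r → X * M * J * r ≡ X * (M * r) * J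
  e₁ = solve-∀
  e₂ : ∀ A r L J M → A * r * L * J + M * r * L ≡ (A * L * J + L * M) * r
  e₂ = solve-∀

takeLE-id : ∀ {A : Set} {m} (m≤m : m ≤ m) (v : Vec A m) → takeLE m m≤m v ≡ v
takeLE-id m≤m       []      = refl
takeLE-id (s≤s m≤m) (x ∷ v) = cong (x ∷_) (takeLE-id m≤m v)

prefixExtractor : ∀ {n d m} k J ε2 (E : Graph n d m) → 0ℚ ℚ.< ε2 → ↧ₙ ε2 ≤ ∣ ↥ ε2 ∣ * (J * J) →
  (∀ {i} → i ≤ k → ∀ S Y → 2 ^ (k ∸ i) ≤ card S → Upper J (truncOut i E) S Y) →
  IsPrefixExtractor n d m k ε2 E
prefixExtractor {n} {d} {m} k J ε2 E 0<ε2 1≤ε2J² upper = full , truncated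
  where
  truncated : ∀ i → i ≤ k → IsExtractor n d (m ∸ i) (2 ^ (k ∸ i)) ε2 (truncOut i E)
  truncated i i≤k S Y K≤s =
    square-bound (edgeCount (truncOut i E) S Y) (2 ^ d * card S) (card Y) (2 ^ (m ∸ i)) J ε2
      0<ε2 (upper i≤k S Y K≤s) (upper-∁⇒lower J (truncOut i E) S Y (upper i≤k S (∁ Y) K≤s)) 1≤ε2J²
    where
    instance
      L≢0 : NonZero (2 ^ d * card S)
      L≢0 = >-nonZero (*-mono-< (m^n>0 2 d) (<-≤-trans (m^n>0 2 (k ∸ i)) K≤s))
      Mᵢ≢0 : NonZero (2 ^ (m ∸ i))
      Mᵢ≢0 = m^n≢0 2 (m ∸ i)
  full : IsExtractor n d m (2 ^ k) ε2 E
  full S Y K≤s =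
    -- The untruncated extractor is the case `i = 0`; `truncOut 0 E` agrees with `E` only pointwise,
    -- by `takeLE-id`.
    subst (λ x → let δ = (x over (2 ^ d * card S)) ℚ.- (card Y over (2 ^ m)) in δ ℚ.* δ ℚ.< ε2)
      (edgeCount-cong E (λ _ → refl) (λ v → cong Y (takeLE-id (m∸n≤m m 0) v)))
      (truncated 0 z≤n S Y K≤s)

-- Choice of the accuracy `1/J` and of the graph

-- Used with `e = 2 log(1/ε)`: then `J = 2 ^ j` satisfies `1/J ≤ ε`, and `J²` exceeds `1/ε²` by at
-- most a factor 2.
rounded-half : ∀ e → ∃ λ j → e ≤ j + j × j + j ≤ suc e
rounded-half zero = 0 , z≤n , z≤n
rounded-half (suc zero) = 1 , s≤s z≤n , ≤-refl
rounded-half (suc (suc e)) with j , e≤ , ≤e ← rounded-half e =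
  suc j , subst (2 + e ≤_) (sym eq) (s≤s (s≤s e≤)) , subst (_≤ 3 + e) (sym eq) (s≤s (s≤s ≤e))
  where
  eq : suc j + suc j ≡ 2 + (j + j)
  eq = cong suc (+-suc j j)

-- With `n = 2 ^ a` the equation for `d` reads `ε² = 2^(a + 7 - d)`, so the first conclusion says
-- `1/J ≤ ε` for `J = 2 ^ j`.
prefix-upper : ∀ {a k} d → k ≤ 2 ^ a →
  ∃ λ j → d ≤ j + j + (a + 7) × ∃ λ (E : Graph (2 ^ a) d (k + a)) →
    ∀ {i} → i ≤ k → ∀ S Y → 2 ^ (k ∸ i) ≤ card S → Upper (2 ^ j) (truncOut i E) S Y
prefix-upper {a} {k} d k≤n with d ≤? a + 7
-- This is the case `ε ≥ 1`: `J = 1` and any graph will do.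
... | yes d≤ = 0 , d≤ , E₀ , λ {i} i≤k S Y K≤s → upper-1 (truncOut i E₀) S Y (<-≤-trans (m^n>0 2 (k ∸ i)) K≤s)
  where
  E₀ : Graph (2 ^ a) d (k + a)
  E₀ _ _ = replicate _ true
... | no d≰ with j , e≤2j , 2j≤1+e ← rounded-half (d ∸ (a + 7)) =
  j , d≤ , proj₁ U.∃-good , λ {i} i≤k S Y K≤s →
    ¬isBad⇒upper (2 ^ j) (proj₁ U.∃-good) S i Y (proj₂ U.∃-good i≤k S Y K≤s)
  where
  open ≤-Reasoning
  e = d ∸ (a + 7)
  d≡ : e + (a + 7) ≡ d
  d≡ = m∸n+n≡m (<⇒≤ (≰⇒> d≰))
  d≤ : d ≤ j + j + (a + 7)
  d≤ = subst (_≤ j + j + (a + 7)) d≡ (+-monoˡ-≤ (a + 7) e≤2j)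
  f = d ∸ (4 + (j + j))
  -- The constant 7 is 4 + 2 + 1: the factor 16 in `(4 * J)²`, the factor 4 in `4 * n ≤ g`, and one
  -- bit lost in rounding `ε`.
  large : 4 + (j + j) + (2 + a) ≤ d
  large = begin
    4 + (j + j) + (2 + a)      ≤⟨ +-monoˡ-≤ (2 + a) (+-monoʳ-≤ 4 2j≤1+e) ⟩
    4 + suc e + (2 + a)        ≡⟨ e₁ e a ⟩
    e + (a + 7)                ≡⟨ d≡ ⟩
    d                          ∎
    where
    e₁ : ∀ e a → 4 + (1 + e) + (2 + a) ≡ e + (a + 7)
    e₁ = solve-∀
  2^d≡ : 2 ^ d ≡ 4 * 2 ^ j * (4 * 2 ^ j) * 2 ^ f
  2^d≡ = begin-equality
    2 ^ d                              ≡⟨ cong (2 ^_) (m+[n∸m]≡n (m+n≤o⇒m≤o (4 + (j + j)) large)) ⟨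
    2 ^ (4 + (j + j) + f)              ≡⟨ ^-distribˡ-+-* 2 (4 + (j + j)) f ⟩
    2 ^ (4 + (j + j)) * 2 ^ f          ≡⟨ cong (_* 2 ^ f) (trans (^-distribˡ-+-* 2 4 (j + j)) (cong (16 *_) (^-distribˡ-+-* 2 j j))) ⟩
    16 * (2 ^ j * 2 ^ j) * 2 ^ f       ≡⟨ cong (_* 2 ^ f) (e₂ (2 ^ j)) ⟩
    4 * 2 ^ j * (4 * 2 ^ j) * 2 ^ f    ∎
    where
    e₂ : ∀ J → 16 * (J * J) ≡ 4 * J * (4 * J)
    e₂ = solve-∀
  4n≤2^f : 4 * 2 ^ a ≤ 2 ^ f
  4n≤2^f = subst (_≤ 2 ^ f) (^-distribˡ-+-* 2 2 a)
    (^-monoʳ-≤ 2 (m+n≤o⇒m≤o∸n (2 + a) (subst (_≤ d) (+-comm (4 + (j + j)) (2 + a)) large)))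
  module U = UnionBound {2 ^ a} {k} {d} {k + a} (m^n>0 2 a) k≤n (2 ^ j) (2 ^ f) {{m^n≢0 2 j}} 2^d≡ 4n≤2^f
    (λ {i} i≤k → trans (cong (2 ^_) (+-∸-comm a i≤k)) (^-distribˡ-+-* 2 (k ∸ i) a))

-- Reading off the parameters and conclusion

2^-cancel-≤ : ∀ k m → 2 ^ k ≤ 2 ^ m → k ≤ m
2^-cancel-≤ k m le with k ≤? m
... | yes k≤m = k≤m
... | no k≰m  = contradiction le (<⇒≱ (^-monoʳ-< 2 (s≤s (s≤s z≤n)) (≰⇒> k≰m)))

-- The two equations on the parameters force n to be a power of two.
parameters : ∀ c n k d m ε2 → 0 < n → 0ℚ ℚ.< ε2 →
  ε2 ℚ.* pow2 (+ d) ≡ nat n ℚ.* pow2 (+ c) →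
  pow2 (+ m) ℚ.* pow2 (+ c) ≡ (pow2 (+ k) ℚ.* pow2 (+ d)) ℚ.* ε2 →
  ∃ λ a → n ≡ 2 ^ a × m ≡ k + a × ∣ ↥ ε2 ∣ * 2 ^ d ≡ 2 ^ (a + c) * ↧ₙ ε2
parameters c n k d m ε2 0<n 0<ε2 eq₁ eq₂ = m ∸ k , n≡ , sym m≡ , trans p2^d≡ (cong (_* q) n*2^c≡)
  where
  p = ∣ ↥ ε2 ∣
  q = ↧ₙ ε2
  p2^d≡ : p * 2 ^ d ≡ n * 2 ^ c * q
  p2^d≡ = *-nat-numerators ε2 (2 ^ d) (n * 2 ^ c) (trans eq₁ (nat-* n (2 ^ c))) 0<ε2
  p2^k2^d≡ : p * (2 ^ k * 2 ^ d) ≡ 2 ^ m * 2 ^ c * q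
  p2^k2^d≡ = *-nat-numerators ε2 (2 ^ k * 2 ^ d) (2 ^ m * 2 ^ c)
    (trans (trans (cong (ε2 ℚ.*_) (sym (nat-* (2 ^ k) (2 ^ d)))) (ℚ.*-comm ε2 _))
           (trans (sym eq₂) (nat-* (2 ^ m) (2 ^ c)))) 0<ε2
  -- Combining the two equations eliminates `ε2` and `d`; the equal constants cancel.
  2^m≡ : 2 ^ m ≡ 2 ^ k * n
  2^m≡ = *-cancelʳ-≡ _ _ (2 ^ c * q) {{m*n≢0 (2 ^ c) q {{m^n≢0 2 c}}}} (begin
    2 ^ m * (2 ^ c * q)          ≡⟨ *-assoc (2 ^ m) (2 ^ c) q ⟨
    2 ^ m * 2 ^ c * q            ≡⟨ p2^k2^d≡ ⟨
    p * (2 ^ k * 2 ^ d)          ≡⟨ e₁ p (2 ^ k) (2 ^ d) ⟩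
    2 ^ k * (p * 2 ^ d)          ≡⟨ cong (2 ^ k *_) p2^d≡ ⟩
    2 ^ k * (n * 2 ^ c * q)      ≡⟨ e₂ (2 ^ k) n (2 ^ c) q ⟩
    2 ^ k * n * (2 ^ c * q)      ∎)
    where
    open ≡-Reasoning
    e₁ : ∀ p k d → p * (k * d) ≡ k * (p * d)
    e₁ = solve-∀
    e₂ : ∀ k n b q → k * (n * b * q) ≡ k * n * (b * q)
    e₂ = solve-∀
  m≡ : k + (m ∸ k) ≡ m
  m≡ = m+[n∸m]≡n (2^-cancel-≤ k m (subst (2 ^ k ≤_) (sym 2^m≡) (m≤m*n (2 ^ k) n {{>-nonZero 0<n}})))
  n≡ : n ≡ 2 ^ (m ∸ k)
  n≡ = *-cancelˡ-≡ _ _ (2 ^ k) {{m^n≢0 2 k}}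
    (trans (sym 2^m≡) (trans (cong (2 ^_) (sym m≡)) (^-distribˡ-+-* 2 k (m ∸ k))))
  n*2^c≡ : n * 2 ^ c ≡ 2 ^ (m ∸ k + c)
  n*2^c≡ = trans (cong (_* 2 ^ c) n≡) (sym (^-distribˡ-+-* 2 (m ∸ k) c))

accuracy-bound : ∀ p q d b j → p * 2 ^ d ≡ 2 ^ b * q → d ≤ j + j + b → q ≤ p * (2 ^ j * 2 ^ j)
accuracy-bound p q d b j eq d≤ = *-cancelˡ-≤ (2 ^ b) {{m^n≢0 2 b}} (begin
  2 ^ b * q                        ≡⟨ eq ⟨
  p * 2 ^ d                        ≤⟨ *-monoʳ-≤ p (^-monoʳ-≤ 2 d≤) ⟩
  p * 2 ^ (j + j + b)              ≡⟨ cong (p *_) (trans (^-distribˡ-+-* 2 (j + j) b) (cong (_* 2 ^ b) (^-distribˡ-+-* 2 j j))) ⟩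
  p * (2 ^ j * 2 ^ j * 2 ^ b)      ≡⟨ e₁ p (2 ^ j) (2 ^ b) ⟩
  2 ^ b * (p * (2 ^ j * 2 ^ j))    ∎)
  where
  open ≤-Reasoning
  e₁ : ∀ p J b → p * (J * J * b) ≡ b * (p * (J * J))
  e₁ = solve-∀

prefixExtractor-exists : ∀ {n k d m} ε2 → k ≤ n → 0ℚ ℚ.< ε2 →
  (∃ λ a → n ≡ 2 ^ a × m ≡ k + a × ∣ ↥ ε2 ∣ * 2 ^ d ≡ 2 ^ (a + 7) * ↧ₙ ε2) →
  Σ (Graph n d m) (IsPrefixExtractor n d m k ε2)
prefixExtractor-exists {k = k} {d} ε2 k≤n 0<ε2 (a , refl , refl , accuracy)
  with j , d≤ , E , upper ← prefix-upper {a} {k} d k≤n =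
  E , prefixExtractor k (2 ^ j) ε2 E 0<ε2 (accuracy-bound ∣ ↥ ε2 ∣ (↧ₙ ε2) d (a + 7) j accuracy d≤) upper

theorem5 : Σ ℤ λ c₁ → Σ ℤ λ c₂ →
    (n k : ℕ) → 1 < k → k ≤ n →
    (ε2 : ℚ) → 0ℚ ℚ.< ε2 →
    (d m : ℕ) →
    ε2 ℚ.* pow2 (+ d) ≡ nat n ℚ.* pow2 c₁ →
    pow2 (+ m) ℚ.* pow2 c₂ ≡ (pow2 (+ k) ℚ.* pow2 (+ d)) ℚ.* ε2 →
    Σ (Vec Bool n → Vec Bool d → Vec Bool m) λ E → IsPrefixExtractor n d m k ε2 E
-- Equal constants give `m = k + log n`, the output length for which the union bound over tests is
-- affordable.
theorem5 = + 7 , + 7 , λ n k 1<k k≤n ε2 0<ε2 d m eq₁ eq₂ →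
  prefixExtractor-exists ε2 k≤n 0<ε2 (parameters 7 n k d m ε2 (≤-trans (<⇒≤ 1<k) k≤n) 0<ε2 eq₁ eq₂)
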